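{- For every test $T:A\to B$ on $2^{\mathbb N}$ there exists a Borel probability measure $\mu$ on $2^{\mathbb N}$ which passes $T$, i.e. such that $T(\mu)(\sigma)\le \mu(\sigma)$ for all $\sigma\in 2^{<\mathbb N}$.
   Context: $2^{<\mathbb N}$ is the set of finite binary strings, $\emptyset$ the empty string, $|\sigma|$ the length of $\sigma$, and $\sigma\,\hat{}\,\tau$ denotes concatenation. A Borel probability measure on Cantor space $2^{\mathbb N}$ is identified with its values on cylinder sets, i.e. with a function $\mu:2^{<\mathbb N}\to[0,1]$ such that $\mu(\emptyset)=1$ and $\mu(\sigma)=\mu(\sigma\,\hat{}\,0)+\mu(\sigma\,\hat{}\,1)$. A (continuous probability) semimeasure is a function $\mu:2^{<\mathbb N}\to[0,1]$ with $\mu(\emptyset)=1$ and $\mu(\sigma)\ge\mu(\sigma\,\hat{}\,0)+\mu(\sigma\,\hat{}\,1)$ for all $\sigma$. Conditions on measures: $A$ is the set of partial functions $f=(f_1,f_2)$ with finite domain $\mathrm{dom}(f)\subset 2^{<\mathbb N}$ and values in $\{n/2^k:n,k\in\mathbb N\}^2$, such that there is a Borel probability measure $\mu$ with $f_1(\sigma)<\mu(\sigma)<f_2(\sigma)$ for all $\sigma\in\mathrm{dom}(f)$; in this case we write $\mu\models f$. Order: $f\le_A g$ iff $\mathrm{dom}(f)\subseteq\mathrm{dom}(g)$ and $[f_1(\sigma),f_2(\sigma)]\supseteq[g_1(\sigma),g_2(\sigma)]$ for all $\sigma\in\mathrm{dom}(f)$. Conditions on semimeasures: $B$ is the set of semimeasures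 with rational values for which there is $n$ such that $|\sigma|>n$ implies the value at $\sigma$ is $0$. Order: $x\le_B y$ iff $x(\sigma)\le y(\sigma)$ for all $\sigma$. A test on $2^{\mathbb N}$ is a nondecreasing function $T:(A,\le_A)\to(B,\le_B)$. For a Borel probability measure $\mu$, $T(\mu)$ denotes the semimeasure $T(\mu)(\sigma)=\sup\{T(a)(\sigma): a\in A,\ \mu\models a\}$. -}

module Defs where

open import Data.Bool using (Bool; true; false)
open import Data.Integer using (+_)
open import Data.List using (List; []; _∷ʳ_; length)
open import Data.List.Membership.Propositional using (_∈_)
open import Data.Maybe using (Maybe; just; Is-just)
open import Data.Nat using (ℕ; suc; _^_)
import Data.Nat as ℕ
import Data.Nat.Properties as ℕ
import Data.Nat.Tactic.RingSolver as ℕ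
open import Data.Product using (Σ; ∃; ∃₂; _×_; _,_; proj₁)
open import Data.Rational using (ℚ; 0ℚ; 1ℚ; ∣_∣; _/_; toℚᵘ)
import Data.Rational as ℚ
import Data.Rational.Properties as ℚ
import Data.Rational.Unnormalised as ℚᵘ
import Data.Rational.Unnormalised.Properties as ℚᵘ
open import Function using (_$_)
open import Relation.Binary.PropositionalEquality
  using (_≡_; cong; cong₂; module ≡-Reasoning)

------------------------------------------------------------------------
-- Real numbers, as regular sequences of rationals (Bishop): the n-th
-- term is within 1/(n+1) of the real being represented.

1/1+_ : ℕ → ℚ
1/1+ n = + 1 / suc n

2/1+_ : ℕ → ℚ
2/1+ n = + 2 / suc n

record ℝ : Set where
  constructor mkℝ
  field
    approx  : ℕ → ℚ
    regular : ∀ m n → ∣ approx m ℚ.- approx n ∣ ℚ.≤ 1/1+ m ℚ.+ 1/1+ n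

open ℝ public

infix 4 _≃_ _≤_ _<_
infixl 6 _+_

_≃_ : ℝ → ℝ → Set
x ≃ y = ∀ n → ∣ approx x n ℚ.- approx y n ∣ ℚ.≤ 2/1+ n

_≤_ : ℝ → ℝ → Set
x ≤ y = ∀ n → approx x n ℚ.- approx y n ℚ.≤ 2/1+ n

_<_ : ℝ → ℝ → Set
x < y = ∃ λ n → 2/1+ n ℚ.< approx y n ℚ.- approx x n

private
  0≤1/1+ : ∀ n → 0ℚ ℚ.≤ 1/1+ n
  0≤1/1+ n = ℚ.nonNegative⁻¹ (1/1+ n) {{ℚ.normalize-nonNeg 1 (suc n)}}

fromℚ : ℚ → ℝ
fromℚ q .approx  _   = q
fromℚ q .regular m n = begin
  ∣ q ℚ.- q ∣        ≡⟨ cong ∣_∣ (ℚ.+-inverseʳ q) ⟩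
  0ℚ                 ≤⟨ ℚ.+-mono-≤ (0≤1/1+ m) (0≤1/1+ n) ⟩
  1/1+ m ℚ.+ 1/1+ n  ∎
  where open ℚ.≤-Reasoning

private
  -- 1/(2n+2) + 1/(2n+2) = 1/(n+1)
  halves : ∀ n → let h = 1/1+ (suc (n ℕ.+ n)) in h ℚ.+ h ≡ 1/1+ n
  halves n = ℚ.toℚᵘ-injective $ begin-equality
    toℚᵘ (h ℚ.+ h)        ≃⟨ ℚ.toℚᵘ-homo-+ h h ⟩
    toℚᵘ h ℚᵘ.+ toℚᵘ h    ≃⟨ ℚᵘ.+-cong (ℚ.toℚᵘ-fromℚᵘ hᵘ) (ℚ.toℚᵘ-fromℚᵘ hᵘ) ⟩
    hᵘ ℚᵘ.+ hᵘ            ≃⟨ ℚᵘ.*≡* (cong +_ (identity n)) ⟩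
    ℚᵘ.mkℚᵘ (+ 1) n       ≃⟨ ℚ.toℚᵘ-fromℚᵘ (ℚᵘ.mkℚᵘ (+ 1) n) ⟨
    toℚᵘ (1/1+ n)         ∎
    where
    open ℚᵘ.≤-Reasoning
    k  = suc (n ℕ.+ n)
    h  = 1/1+ k
    hᵘ = ℚᵘ.mkℚᵘ (+ 1) k
    identity : ∀ n → let d = suc (suc (n ℕ.+ n)) in
               (1 ℕ.* d ℕ.+ 1 ℕ.* d) ℕ.* suc n ≡ 1 ℕ.* (d ℕ.* d)
    identity = ℕ.solve-∀

  interchange : ∀ a b c d → (a ℚ.+ b) ℚ.+ (c ℚ.+ d) ≡ (a ℚ.+ c) ℚ.+ (b ℚ.+ d)
  interchange a b c d = begin
    (a ℚ.+ b) ℚ.+ (c ℚ.+ d)  ≡⟨ ℚ.+-assoc a b (c ℚ.+ d) ⟩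
    a ℚ.+ (b ℚ.+ (c ℚ.+ d))  ≡⟨ cong (a ℚ.+_) (ℚ.+-assoc b c d) ⟨
    a ℚ.+ ((b ℚ.+ c) ℚ.+ d)  ≡⟨ cong (λ t → a ℚ.+ (t ℚ.+ d)) (ℚ.+-comm b c) ⟩
    a ℚ.+ ((c ℚ.+ b) ℚ.+ d)  ≡⟨ cong (a ℚ.+_) (ℚ.+-assoc c b d) ⟩
    a ℚ.+ (c ℚ.+ (b ℚ.+ d))  ≡⟨ ℚ.+-assoc a c (b ℚ.+ d) ⟨
    (a ℚ.+ c) ℚ.+ (b ℚ.+ d)  ∎
    where open ≡-Reasoning

-- The summands are evaluated at index 2n+1 to keep the sum regular.
_+_ : ℝ → ℝ → ℝ
(x + y) .approx n = approx x (suc (n ℕ.+ n)) ℚ.+ approx y (suc (n ℕ.+ n))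
(x + y) .regular m n = begin
  ∣ (a ℚ.+ b) ℚ.- (c ℚ.+ d) ∣
    ≡⟨ cong (λ t → ∣ (a ℚ.+ b) ℚ.+ t ∣) (ℚ.neg-distrib-+ c d) ⟩
  ∣ (a ℚ.+ b) ℚ.+ (ℚ.- c ℚ.+ ℚ.- d) ∣
    ≡⟨ cong ∣_∣ (interchange a b (ℚ.- c) (ℚ.- d)) ⟩
  ∣ (a ℚ.- c) ℚ.+ (b ℚ.- d) ∣
    ≤⟨ ℚ.∣p+q∣≤∣p∣+∣q∣ (a ℚ.- c) (b ℚ.- d) ⟩
  ∣ a ℚ.- c ∣ ℚ.+ ∣ b ℚ.- d ∣
    ≤⟨ ℚ.+-mono-≤ (regular x m′ n′) (regular y m′ n′) ⟩
  (1/1+ m′ ℚ.+ 1/1+ n′) ℚ.+ (1/1+ m′ ℚ.+ 1/1+ n′)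
    ≡⟨ interchange (1/1+ m′) (1/1+ n′) (1/1+ m′) (1/1+ n′) ⟩
  (1/1+ m′ ℚ.+ 1/1+ m′) ℚ.+ (1/1+ n′ ℚ.+ 1/1+ n′)
    ≡⟨ cong₂ ℚ._+_ (halves m) (halves n) ⟩
  1/1+ m ℚ.+ 1/1+ n
    ∎
  where
  open ℚ.≤-Reasoning
  m′ = suc (m ℕ.+ m)
  n′ = suc (n ℕ.+ n)
  a = approx x m′
  b = approx y m′
  c = approx x n′
  d = approx y n′

record IsSupremum {I : Set} (f : I → ℝ) (s : ℝ) : Set where
  field
    upperBound : ∀ i → f i ≤ s
    least      : ∀ b → (∀ i → f i ≤ b) → s ≤ b

------------------------------------------------------------------------
-- Borel probability measures on Cantor space, given by their values on
-- cylinders; false and true are the bits 0 and 1.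

Str : Set
Str = List Bool

record Measure : Set where
  field
    value    : Str → ℝ
    value≥0  : ∀ σ → fromℚ 0ℚ ≤ value σ
    value≤1  : ∀ σ → value σ ≤ fromℚ 1ℚ
    total    : value [] ≃ fromℚ 1ℚ
    additive : ∀ σ → value σ ≃ value (σ ∷ʳ false) + value (σ ∷ʳ true)

open Measure public

------------------------------------------------------------------------
-- Conditions on measures

-- As n ranges over ℕ, these are the nonnegative dyadic rationals only.
IsDyadic : ℚ → Set
IsDyadic q = ∃₂ λ n k → q ≡ _/_ (+ n) (2 ^ k) {{ℕ.m^n≢0 2 k}}

infix 4 _⊨ᶠ_ _⊨_ _≤A_ _≤B_

_⊨ᶠ_ : Measure → (Str → Maybe (ℚ × ℚ)) → Set
μ ⊨ᶠ f = ∀ σ {p q} → f σ ≡ just (p , q) →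
         fromℚ p < value μ σ × value μ σ < fromℚ q

record A : Set where
  field
    fun         : Str → Maybe (ℚ × ℚ)
    finite      : ∃ λ (xs : List Str) → ∀ σ → Is-just (fun σ) → σ ∈ xs
    dyadic      : ∀ σ {p q} → fun σ ≡ just (p , q) → IsDyadic p × IsDyadic q
    satisfiable : ∃ λ μ → μ ⊨ᶠ fun

_⊨_ : Measure → A → Set
μ ⊨ a = μ ⊨ᶠ A.fun a

-- The intervals of a condition are nonempty (by satisfiability), so the
-- inclusion [p , q] ⊇ [p′ , q′] is comparison of endpoints.
_≤A_ : A → A → Set
f ≤A g = ∀ σ {p q} → A.fun f σ ≡ just (p , q) →
         ∃₂ λ p′ q′ → A.fun g σ ≡ just (p′ , q′) × p ℚ.≤ p′ × q′ ℚ.≤ q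

------------------------------------------------------------------------
-- Conditions on semimeasures

record B : Set where
  field
    val           : Str → ℚ
    val≥0         : ∀ σ → 0ℚ ℚ.≤ val σ
    val≤1         : ∀ σ → val σ ℚ.≤ 1ℚ
    total         : val [] ≡ 1ℚ
    superadditive : ∀ σ → val (σ ∷ʳ false) ℚ.+ val (σ ∷ʳ true) ℚ.≤ val σ
    vanishing     : ∃ λ n → ∀ σ → n ℕ.< length σ → val σ ≡ 0ℚ

_≤B_ : B → B → Set
x ≤B y = ∀ σ → B.val x σ ℚ.≤ B.val y σ

------------------------------------------------------------------------
-- Tests

-- Monotonicity makes a test insensitive to the proof components of a
-- condition: a ≤A b and b ≤A a hold when a and b are the same partial
-- function, and then the values of the test on a and b agree.
record Test : Set where
  field
    apply : A → B
    mono  : ∀ {a b} → a ≤A b → apply a ≤B apply b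

-- ν is the function T(μ), i.e. ν(σ) = sup { T(a)(σ) : a ∈ A, μ ⊨ a }.
_[_]≐_ : Test → Measure → (Str → ℝ) → Set
T [ μ ]≐ ν = ∀ σ → IsSupremum {I = Σ A (μ ⊨_)}
                     (λ i → fromℚ (B.val (Test.apply T (proj₁ i)) σ)) (ν σ)

-- Forming suprema is not constructive, so T(μ) is given by its graph;
-- its existence is part of the claim.
_passes_ : Measure → Test → Set
μ passes T = ∃ λ ν → T [ μ ]≐ ν × (∀ σ → ν σ ≤ value μ σ)

{-# OPTIONS --safe #-}
module Submission where

-- On the dyadic measures of depth n and denominator 4ⁿ, give each point x a
-- colour: a leaf of positive mass along whose branch T (box around x) lies
-- below x.  Such a branch exists, because a semimeasure that is below x at a
-- node of positive mass is below x at a child of positive mass.  Scarf's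
-- pivoting argument, with one linear order per leaf, yields a tight cluster of
-- points showing all colours: every string of length at most n then has a
-- nearby point at which the test is passed.  The pivoting is a parity argument
-- on pairs of a room and a door, with no triangulation.  The clusters have a
-- limit point μ, along which any condition satisfied by μ is eventually weaker
-- than the boxes, so monotonicity of T bounds T(μ) by μ.

open import Defs hiding (_≤_; _<_; _+_)
import Defs as ℝ
open import Axiom.ExcludedMiddle using (ExcludedMiddle)
open import Data.Bool using (Bool; true; false; not)
open import Data.Empty using (⊥; ⊥-elim)
open import Data.Fin using (toℕ)
open import Data.Fin.Properties using (toℕ<n; toℕ-injective)
open import Data.Integer using (+_)
import Data.Integer as ℤ
import Data.Integer.Properties as ℤ
import Data.Integer.Tactic.RingSolver as ℤ-Solver
open import Data.List
  using (List; []; _∷_; _++_; _∷ʳ_; [_]; map; length; lookup; filter; upTo; deduplicate; cartesianProduct; cartesianProductWith)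
open import Data.List.Extrema.Nat using (argmax; argmax-all; f[xs]≤f[argmax])
open import Data.List.Membership.Propositional using (_∈_)
open import Data.List.Membership.Propositional.Properties
  using (∈-∃++; ∈-filter⁺; ∈-filter⁻; ∈-deduplicate⁺; ∈-deduplicate⁻; ∈-map⁺; ∈-upTo⁺; ∈-cartesianProduct⁺; ∈-cartesianProductWith⁺)
open import Data.List.Relation.Binary.Permutation.Propositional using (_↭_; ↭-sym; ↭⇒↭ₛ)
open import Data.List.Relation.Binary.Permutation.Propositional.Properties using (shift; ↭-length; ∈-resp-↭)
import Data.List.Relation.Binary.Permutation.Setoid.Properties as ↭ₛ
open import Data.List.Relation.Unary.All as All using (All)
open import Data.List.Relation.Unary.All.Properties using (all-filter)
open import Data.List.Relation.Unary.AllPairs using (_∷_)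
open import Data.List.Relation.Unary.Any using (here; there; index)
open import Data.List.Relation.Unary.Any.Properties using (lookup-index)
open import Data.List.Relation.Unary.Unique.Propositional using (Unique)
import Data.List.Relation.Unary.Unique.DecPropositional.Properties as Unique
open import Data.Maybe using (Maybe; just; nothing; Is-just)
open import Data.Maybe.Properties using (just-injective)
import Data.Maybe.Relation.Unary.Any as Maybe
open import Data.Nat
  using (ℕ; zero; suc; pred; _+_; _*_; _∸_; _⊓_; _⊔_; _^_; _≤_; _<_; _≤′_; ≤′-refl; ≤′-step; _≤?_; _<?_; z≤n; s≤s; NonZero; >-nonZero)
open import Data.Nat.Binary using (ℕᵇ; 2[1+_]; 1+[2_]; fromℕ)
import Data.Nat.Binary as ℕᵇ
open import Data.Nat.Binary.Properties using (fromℕ-toℕ)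
open import Data.Nat.Induction using (<-wellFounded)
open import Data.Nat.Properties hiding (_≟_)
open import Data.Nat.Tactic.RingSolver using (solve-∀)
open import Data.Product using (Σ; ∃; ∃₂; _×_; _,_; proj₁; proj₂)
open import Data.Rational using (ℚ; 0ℚ; 1ℚ; ∣_∣; _/_; toℚᵘ)
import Data.Rational as ℚ
import Data.Rational.Properties as ℚ
open import Data.Rational.Solver using (module +-*-Solver)
import Data.Rational.Unnormalised as ℚᵘ
import Data.Rational.Unnormalised.Properties as ℚᵘ
open import Data.Sum using (inj₁; inj₂)
open import Data.Unit using (⊤; tt)
open import Data.Vec using (Vec; []; _∷_; replicate)
open import Function using (_∘_; _$_)
open import Induction.WellFounded using (Acc; acc)
open import Level using (0ℓ)
open import Relation.Binary.PropositionalEquality hiding ([_])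
open import Relation.Nullary using (¬_; Dec; yes; no; contradiction; ¬?)

-- A test is only monotone, so its value on the box around `x` need not depend continuously on `x`,
-- and a fixed-point theorem for continuous maps has nothing to act on. Accordingly no single grid
-- point is claimed to pass at all strings. It is enough that each string is served by some member
-- of one cluster: a condition that holds at the limit holds with a margin, so it is weaker than the
-- box around every member of a late cluster, whichever of them serves the string at hand. The
-- denominator comes from the size of a room. Lowering the leafwise maxima of a room by one unit
-- each must bring the total below 1, since otherwise a grid point would fit below the room. So the
-- maxima exceed a measure by less than one unit per leaf, that is by less than 2ⁿ units, and units
-- of 4⁻ⁿ turn this into 2⁻ⁿ. Positive mass at the chosen leaf is used twice: a point mass gets the
-- colour of its own leaf, and in a room with all colours every leafwise maximum is at least one
-- unit, so that it can be lowered.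

-- Parity of a matched list

∈⇒↭ : {A : Set} {x : A} {xs : List A} → x ∈ xs → ∃ λ ys → xs ↭ x ∷ ys
∈⇒↭ x∈xs with ys , zs , refl ← ∈-∃++ x∈xs = ys ++ zs , shift _ ys zs

Unique-resp-↭ : {A : Set} {xs ys : List A} → xs ↭ ys → Unique xs → Unique ys
Unique-resp-↭ p = ↭ₛ.Unique-resp-↭ (setoid _) (↭⇒↭ₛ p)

-- Removing an element together with its partner leaves a list that is still closed under `R`,
-- because partners are unique. The matching is a relation, not an involution, since partners are
-- only known to exist.
matching⇒even : {A : Set} (R : A → A → Set) →
                (∀ {x} → ¬ R x x) → (∀ {x y} → R x y → R y x) →
                (∀ {x y z} → R x y → R x z → y ≡ z) →
                ∀ xs → Unique xs → (∀ {x} → x ∈ xs → ∃ λ y → y ∈ xs × R x y) →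
                ∃ λ k → length xs ≡ k + k
matching⇒even {A} R R-irrefl R-sym R-fun xs = go (length xs) xs ≤-refl
  where
  -- The recursive call is on a permuted remnant of the list, so a bound on the length drives the
  -- recursion.
  go : ∀ n (xs : List A) → length xs ≤ n → Unique xs →
       (∀ {x} → x ∈ xs → ∃ λ y → y ∈ xs × R x y) → ∃ λ k → length xs ≡ k + k
  go _       []       _       _           _       = 0 , refl
  go (suc n) (x ∷ xs) (s≤s l) (x∉xs ∷ uniq) partner with partner (here refl)
  ... | y , here refl , Rxy = contradiction Rxy R-irrefl
  ... | y , there y∈xs , Rxy with ∈⇒↭ y∈xs
  ... | zs , p with Unique-resp-↭ p uniq
  ... | y∉zs ∷ uniq′ with go n zs (≤-trans (n≤1+n _) (≤-trans (≤-reflexive (sym (↭-length p))) l)) uniq′ partner′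
    where
    partner′ : ∀ {z} → z ∈ zs → ∃ λ w → w ∈ zs × R z w
    partner′ {z} z∈zs with partner (there (∈-resp-↭ (↭-sym p) (there z∈zs)))
    ... | w , here refl , Rzx = contradiction (R-fun Rxy (R-sym Rzx)) (All.lookup y∉zs z∈zs)
    ... | w , there w∈xs , Rzw with ∈-resp-↭ p w∈xs
    ...   | here refl  = contradiction (R-fun (R-sym Rxy) (R-sym Rzw))
                           (All.lookup x∉xs (∈-resp-↭ (↭-sym p) (there z∈zs)))
    ...   | there w∈zs = w , w∈zs , Rzw
  ... | k , eq = suc k , (begin
    suc (length xs)        ≡⟨ cong suc (↭-length p) ⟩
    suc (suc (length zs))  ≡⟨ cong (suc ∘ suc) eq ⟩
    suc (suc (k + k))      ≡⟨ cong suc (+-suc k k) ⟨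
    suc k + suc k          ∎)
    where open ≡-Reasoning

double≢1+double : ∀ k l → k + k ≢ suc (l + l)
double≢1+double (suc k) (suc l) eq =
  double≢1+double k l (suc-injective (suc-injective (trans (cong suc (sym (+-suc k k))) (trans eq (cong (suc ∘ suc) (+-suc l l))))))
double≢1+double (suc k) zero eq with () ← trans (sym (+-suc k k)) (suc-injective eq)

-- Complete binary trees as functions on their leaves

-- A first-order form of `Path n → A`: by `at-ext` equality is pointwise, and over a finite set of
-- values all trees can be listed. Both are needed in order to count rooms.
data Tree (A : Set) : ℕ → Set where
  leaf : A → Tree A 0
  node : ∀ {n} → Tree A n → Tree A n → Tree A (suc n)

Path : ℕ → Set
Path = Vec Bool

at : ∀ {A n} → Tree A n → Path n → A
at (leaf a)   []          = a
at (node l r) (false ∷ p) = at l p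
at (node l r) (true  ∷ p) = at r p

tabulate : ∀ {A n} → (Path n → A) → Tree A n
tabulate {n = zero}  f = leaf (f [])
tabulate {n = suc n} f = node (tabulate (f ∘ (false ∷_))) (tabulate (f ∘ (true ∷_)))

at-tabulate : ∀ {A n} (f : Path n → A) p → at (tabulate f) p ≡ f p
at-tabulate f []          = refl
at-tabulate f (false ∷ p) = at-tabulate (f ∘ (false ∷_)) p
at-tabulate f (true  ∷ p) = at-tabulate (f ∘ (true ∷_)) p

at-ext : ∀ {A n} (s t : Tree A n) → (∀ p → at s p ≡ at t p) → s ≡ t
at-ext (leaf a)   (leaf b)     eq = cong leaf (eq [])
at-ext (node l r) (node l′ r′) eq =
  cong₂ node (at-ext l l′ (eq ∘ (false ∷_))) (at-ext r r′ (eq ∘ (true ∷_)))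

trees : ∀ {A} → List A → ∀ n → List (Tree A n)
trees xs zero    = map leaf xs
trees xs (suc n) = cartesianProductWith node (trees xs n) (trees xs n)

∈-trees : ∀ {A n} {xs : List A} (t : Tree A n) → (∀ p → at t p ∈ xs) → t ∈ trees xs n
∈-trees (leaf a)   h = ∈-map⁺ leaf (h [])
∈-trees (node l r) h =
  ∈-cartesianProductWith⁺ node (∈-trees l (h ∘ (false ∷_))) (∈-trees r (h ∘ (true ∷_)))

paths : ∀ n → List (Path n)
paths zero    = [ [] ]
paths (suc n) = cartesianProductWith _∷_ (false ∷ true ∷ []) (paths n)

∈-paths : ∀ {n} (p : Path n) → p ∈ paths n
∈-paths []          = here refl
∈-paths (false ∷ p) = ∈-cartesianProductWith⁺ _∷_ {xs = false ∷ true ∷ []} (here refl) (∈-paths p)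
∈-paths (true  ∷ p) = ∈-cartesianProductWith⁺ _∷_ {xs = false ∷ true ∷ []} (there (here refl)) (∈-paths p)

-- Scarf's pivoting argument

module Classical (em : ExcludedMiddle 0ℓ) where

  least : {A : Set} (f : A → ℕ) (P : A → Set) → ∃ P →
          ∃ λ x → P x × (∀ y → P y → f x ≤ f y)
  least {A} f P (x , Px) = go x Px (<-wellFounded (f x))
    where
    go : ∀ x → P x → Acc _<_ (f x) → ∃ λ x → P x × (∀ y → P y → f x ≤ f y)
    go x Px (acc rs) with em {∃ λ y → P y × f y < f x}
    ... | yes (y , Py , y<x) = go y Py (rs y<x)
    ... | no ∄y              = x , Px , λ y Py → ≮⇒≥ λ y<x → ∄y (y , Py , y<x)

  -- The points `v i` act as Scarf's slack vectors. Together `v-max`, `v-min` and `c-v` are the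
  -- entire boundary condition: the colours of all other points are arbitrary.
  module KKM
    {n : ℕ} {Y : Set} (points : List Y) (∈-points : ∀ y → y ∈ points)
    (u : Path n → Y → ℕ) (u-injective : ∀ i {x y} → u i x ≡ u i y → x ≡ y)
    (v : Path n → Y)
    (v-max : ∀ i y → y ≢ v i → u i y < u i (v i))
    (v-min : ∀ {i j} y → i ≢ j → (∀ l → y ≢ v l) → u i (v j) < u i y)
    (c : Y → Path n) (c-v : ∀ i → c (v i) ≡ i)
    (other : ∀ (i : Path n) → ∃ λ j → j ≢ i)
    where

    I : Set
    I = Path n

    _≟_ : {A : Set} (x y : A) → Dec (x ≡ y)
    x ≟ y = em

    v-injective : ∀ {i j} → v i ≡ v j → i ≡ j
    v-injective {i} {j} eq = trans (sym (c-v i)) (trans (cong c eq) (c-v j))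

    -- Scarf's primitive sets: s i is the largest member of the room in the i-th
    -- order, and no point lies below the room in every order.
    record Room (s : I → Y) : Set where
      field
        maximal  : ∀ i j → j ≢ i → u i (s j) < u i (s i)
        dominant : ∀ y → ∃ λ i → u i (s i) ≤ u i y

      injective : ∀ {i j} → s i ≡ s j → i ≡ j
      injective {i} {j} eq with i ≟ j
      ... | yes i≡j = i≡j
      ... | no  i≢j = contradiction (cong (u j) eq) (<⇒≢ (maximal j i i≢j))

      ¬all-below : ∀ {y} → ¬ (∀ i → u i y < u i (s i))
      ¬all-below {y} below with i , le ← dominant y = <⇒≱ (below i) le

    open Room

    -- Dominance of the first room at `t k` has a witness, and at an index other than `k`, where the
    -- rooms agree, it would contradict maximality in the second. So `s k` is at most `t k` in order
    -- `k`, and the converse is symmetric.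
    room-determined : ∀ {s t} k → Room s → Room t → (∀ l → l ≢ k → s l ≡ t l) → s k ≡ t k
    room-determined {s} {t} k S T agree =
      u-injective k (≤-antisym (below S T agree) (below T S λ l l≢k → sym (agree l l≢k)))
      where
      below : ∀ {s t} → Room s → Room t → (∀ l → l ≢ k → s l ≡ t l) → u k (s k) ≤ u k (t k)
      below {s} {t} S T agree with i , le ← dominant S (t k) with i ≟ k
      ... | yes refl = le
      ... | no i≢k   = contradiction (subst (λ y → u i y ≤ u i (t k)) (agree i i≢k) le)
                         (<⇒≱ (maximal T i k (i≢k ∘ sym)))

    module _ (i₀ : I) where

      -- A room with one of its doors: without s k, the room has every colour
      -- except i₀ exactly once.
      record Flag (s : I → Y) (k : I) : Set where
        field
          room : Room s
          off  : ∀ j → j ≢ k → c (s j) ≢ i₀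
          onto : ∀ i → i ≢ i₀ → ∃ λ j → j ≢ k × c (s j) ≡ i
          one  : ∀ {i j} → i ≢ k → j ≢ k → c (s i) ≡ c (s j) → i ≡ j

      open Flag

      flag-resp : ∀ {s t k} → (∀ l → s l ≡ t l) → Flag s k → Flag t k
      flag-resp {s} {t} {k} s≗t F = record
        { room = record
          { maximal  = λ i j j≢i → subst₂ (λ x y → u i x < u i y) (s≗t j) (s≗t i) (maximal (room F) i j j≢i)
          ; dominant = λ y → let i , le = dominant (room F) y in i , subst (λ x → u i x ≤ u i y) (s≗t i) le
          }
        ; off  = λ j j≢k → subst (λ y → c y ≢ i₀) (s≗t j) (off F j j≢k)
        ; onto = λ i i≢i₀ → let j , j≢k , eq = onto F i i≢i₀ in j , j≢k , trans (cong c (sym (s≗t j))) eq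
        ; one  = λ {i} {j} i≢k j≢k eq →
                   one F i≢k j≢k (trans (cong c (s≗t i)) (trans eq (cong c (sym (s≗t j)))))
        }

      -- Exchanging the omitted point for a door point of the same colour does not change the
      -- colours of the door.
      swap : ∀ {s k j} → Flag s k → j ≢ k → c (s j) ≡ c (s k) → Flag s j
      swap {s} {k} {j} F j≢k eq = record { room = room F ; off = off′ ; onto = onto′ ; one = one′ }
        where
        off′ : ∀ l → l ≢ j → c (s l) ≢ i₀
        off′ l l≢j with l ≟ k
        ... | yes refl = subst (_≢ i₀) eq (off F j j≢k)
        ... | no  l≢k  = off F l l≢k
        onto′ : ∀ i → i ≢ i₀ → ∃ λ l → l ≢ j × c (s l) ≡ i
        onto′ i i≢i₀ with onto F i i≢i₀
        ... | l , l≢k , ceq with l ≟ j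
        ...   | yes refl = k , j≢k ∘ sym , trans (sym eq) ceq
        ...   | no  l≢j  = l , l≢j , ceq
        one′ : ∀ {a b} → a ≢ j → b ≢ j → c (s a) ≡ c (s b) → a ≡ b
        one′ {a} {b} a≢j b≢j ceq with a ≟ k | b ≟ k
        ... | yes refl | yes refl = refl
        ... | yes refl | no b≢k   = contradiction (sym (one F j≢k b≢k (trans eq ceq))) b≢j
        ... | no a≢k   | yes refl = contradiction (one F a≢k j≢k (trans ceq (sym eq))) a≢j
        ... | no a≢k   | no b≢k   = one F a≢k b≢k ceq

      -- On a door of `s` one point is maximal at two indices: its own, `k′`, and the vacated `k`.
      -- In the adjacent room it carries the index `k`, and the other door points keep theirs.
      record SameDoor (s : I → Y) (k : I) (s′ : I → Y) (k′ : I) : Set where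
        field
          distinct : k ≢ k′
          moved    : s k′ ≡ s′ k
          kept     : ∀ l → l ≢ k → l ≢ k′ → s l ≡ s′ l

      open SameDoor

      sameDoor-sym : ∀ {s k s′ k′} → SameDoor s k s′ k′ → SameDoor s′ k′ s k
      sameDoor-sym d .distinct = distinct d ∘ sym
      sameDoor-sym d .moved    = sym (moved d)
      sameDoor-sym d .kept l l≢k′ l≢k = sym (kept d l l≢k l≢k′)

      -- The entering index is the unique maximiser of u k on the door.
      sameDoor-max : ∀ {s k s′ k′} → Room s′ → SameDoor s k s′ k′ →
                     ∀ l → l ≢ k → l ≢ k′ → u k (s l) < u k (s k′)
      sameDoor-max {k = k} R′ d l l≢k l≢k′ =
        subst₂ _<_ (cong (u k) (sym (kept d l l≢k l≢k′))) (cong (u k) (sym (moved d)))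
          (maximal R′ k l l≢k)

      sameDoor-index : ∀ {s k s′ k′ s″ k″} → Room s′ → Room s″ →
                       SameDoor s k s′ k′ → SameDoor s k s″ k″ → k′ ≡ k″
      sameDoor-index {k′ = k′} {k″ = k″} R′ R″ d e with k′ ≟ k″
      ... | yes eq = eq
      ... | no neq = contradiction (sameDoor-max R″ e k′ (distinct d ∘ sym) neq)
                       (<-asym (sameDoor-max R′ d k″ (distinct e ∘ sym) (neq ∘ sym)))

      sameDoor-room : ∀ {s k s′ s″ k′} → Room s′ → Room s″ →
                      SameDoor s k s′ k′ → SameDoor s k s″ k′ → ∀ l → s′ l ≡ s″ l
      sameDoor-room {k = k} {s′} {s″} {k′} R′ R″ d e = everywhere
        where
        agree : ∀ l → l ≢ k′ → s′ l ≡ s″ l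
        agree l l≢k′ with l ≟ k
        ... | yes refl = trans (sym (moved d)) (moved e)
        ... | no l≢k   = trans (sym (kept d l l≢k l≢k′)) (kept e l l≢k l≢k′)
        everywhere : ∀ l → s′ l ≡ s″ l
        everywhere l with l ≟ k′
        ... | yes refl = room-determined k′ R′ R″ agree
        ... | no l≢k′  = agree l l≢k′

      -- The colour conditions see only the set of door points, which `door` and `door⁻¹` translate
      -- between the two indexings.
      sameDoor-flag : ∀ {s k s′ k′} → Flag s k → Room s′ → SameDoor s k s′ k′ → Flag s′ k′
      sameDoor-flag {s} {k} {s′} {k′} F R′ d =
        record { room = R′ ; off = off′ ; onto = onto′ ; one = one′ }
        where
        door : ∀ l → l ≢ k′ → ∃ λ m → m ≢ k × s m ≡ s′ l
        door l l≢k′ with l ≟ k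
        ... | yes refl = k′ , distinct d ∘ sym , moved d
        ... | no l≢k   = l , l≢k , kept d l l≢k l≢k′
        door⁻¹ : ∀ m → m ≢ k → ∃ λ l → l ≢ k′ × s m ≡ s′ l
        door⁻¹ m m≢k with m ≟ k′
        ... | yes refl = k , distinct d , moved d
        ... | no m≢k′  = m , m≢k′ , kept d m m≢k m≢k′
        off′ : ∀ l → l ≢ k′ → c (s′ l) ≢ i₀
        off′ l l≢k′ with m , m≢k , eq ← door l l≢k′ = subst (λ y → c y ≢ i₀) eq (off F m m≢k)
        onto′ : ∀ i → i ≢ i₀ → ∃ λ l → l ≢ k′ × c (s′ l) ≡ i
        onto′ i i≢i₀ with m , m≢k , ceq ← onto F i i≢i₀ with l , l≢k′ , eq ← door⁻¹ m m≢k =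
          l , l≢k′ , trans (cong c (sym eq)) ceq
        one′ : ∀ {a b} → a ≢ k′ → b ≢ k′ → c (s′ a) ≡ c (s′ b) → a ≡ b
        one′ {a} {b} a≢ b≢ ceq with m , m≢k , eq ← door a a≢ with m′ , m′≢k , eq′ ← door b b≢ =
          injective R′ (trans (sym eq) (trans (cong s m≡m′) eq′))
          where
          m≡m′ : m ≡ m′
          m≡m′ = one F m≢k m′≢k (trans (cong c eq) (trans ceq (cong c (sym eq′))))

      -- Pivoting: drop s k, let the k-maximal remaining point s j take over
      -- index k, and refill index j with the j-least admissible point.
      module Pivot {s k j} (F : Flag s k) (j≢k : j ≢ k)
                   (j-max : ∀ l → l ≢ k → u k (s l) ≤ u k (s j)) where

        S : Room s
        S = room F

        record Admissible (y : Y) : Set where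
          field
            below-k : u k y < u k (s j)
            below   : ∀ l → l ≢ k → l ≢ j → u l y < u l (s l)

        open Admissible

        module _ {x} (adm : Admissible x) (x-least : ∀ y → Admissible y → u j x ≤ u j y) where

          s′ : I → Y
          s′ l with l ≟ j | l ≟ k
          ... | yes _ | _     = x
          ... | no  _ | yes _ = s j
          ... | no  _ | no  _ = s l

          s′-j : s′ j ≡ x
          s′-j with j ≟ j
          ... | yes _ = refl
          ... | no j≢j = contradiction refl j≢j

          s′-k : s′ k ≡ s j
          s′-k with k ≟ j | k ≟ k
          ... | yes refl | _      = contradiction refl j≢k
          ... | no _     | yes _  = refl
          ... | no _     | no k≢k = contradiction refl k≢k

          s′-l : ∀ l → l ≢ k → l ≢ j → s′ l ≡ s l
          s′-l l l≢k l≢j with l ≟ j | l ≟ k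
          ... | yes l≡j | _       = contradiction l≡j l≢j
          ... | no _    | yes l≡k = contradiction l≡k l≢k
          ... | no _    | no _    = refl

          data View (l : I) : Set where
            is-j  : l ≡ j → s′ l ≡ x → View l
            is-k  : l ≡ k → s′ l ≡ s j → View l
            is-l : l ≢ k → l ≢ j → s′ l ≡ s l → View l

          view : ∀ l → View l
          view l with l ≟ j | l ≟ k
          ... | yes refl | _        = is-j refl s′-j
          ... | no _     | yes refl = is-k refl s′-k
          ... | no l≢j   | no l≢k   = is-l l≢k l≢j (s′-l l l≢k l≢j)

          below-k′ : ∀ l → l ≢ k → l ≢ j → u k (s l) < u k (s j)
          below-k′ l l≢k l≢j =
            ≤∧≢⇒< (j-max l l≢k) λ eq → l≢j (injective S (u-injective k eq))

          -- The old room's dominance at `x` needs a witness, and `j` is the only index at which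
          -- admissibility does not put `x` below the old room. Equality is excluded because `x`
          -- lies strictly below `s j` in order `k`.
          s-j<x : u j (s j) < u j x
          s-j<x with i , le ← dominant S x with i ≟ j | i ≟ k
          ... | yes refl | _ = ≤∧≢⇒< le λ eq → <⇒≢ (below-k adm) (cong (u k) (u-injective j (sym eq)))
          ... | no _ | yes refl = contradiction le (<⇒≱ (<-trans (below-k adm) (maximal S k j j≢k)))
          ... | no i≢j | no i≢k = contradiction le (<⇒≱ (below adm i i≢k i≢j))

          maximal′ : ∀ a b → b ≢ a → u a (s′ b) < u a (s′ a)
          maximal′ a b b≢a with view a | view b
          ... | is-j refl _  | is-j refl _  = contradiction refl b≢a
          ... | is-j refl ea | is-k refl eb rewrite ea | eb = s-j<x
          ... | is-j refl ea | is-l _ b≢j eb rewrite ea | eb = <-trans (maximal S j b b≢j) s-j<x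
          ... | is-k refl ea | is-j refl eb rewrite ea | eb = below-k adm
          ... | is-k refl _  | is-k refl _  = contradiction refl b≢a
          ... | is-k refl ea | is-l b≢k b≢j eb rewrite ea | eb = below-k′ b b≢k b≢j
          ... | is-l a≢k a≢j ea | is-j refl eb rewrite ea | eb = below adm a a≢k a≢j
          ... | is-l a≢k a≢j ea | is-k refl eb rewrite ea | eb = maximal S a j (a≢j ∘ sym)
          ... | is-l a≢k a≢j ea | is-l _ _ eb rewrite ea | eb = maximal S a b b≢a

          -- The bounds in `Admissible` are those set by `s′` away from `j`. So a point below the
          -- new room in every order would be admissible, and then it could not be `j`-below the
          -- `j`-least admissible point.
          dominant′ : ∀ y → ∃ λ i → u i (s′ i) ≤ u i y
          dominant′ y with em {Admissible y}
          ... | yes adm-y = j , subst (λ z → u j z ≤ u j y) (sym s′-j) (x-least y adm-y)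
          ... | no ¬adm with em {∃ λ i → u i (s′ i) ≤ u i y}
          ...   | yes d = d
          ...   | no ∄i = contradiction (record
            { below-k = subst (λ z → u k y < u k z) s′-k (≰⇒> λ le → ∄i (k , le))
            ; below   = λ l l≢k l≢j → subst (λ z → u l y < u l z) (s′-l l l≢k l≢j) (≰⇒> λ le → ∄i (l , le))
            }) ¬adm

          room′ : Room s′
          room′ = record { maximal = maximal′ ; dominant = dominant′ }

          door′ : SameDoor s k s′ j
          door′ = record
            { distinct = j≢k ∘ sym
            ; moved    = sym s′-k
            ; kept     = λ l l≢k l≢j → sym (s′-l l l≢k l≢j)
            }

        pivot : ∃ Admissible → ∃ λ s′ → Room s′ × SameDoor s k s′ j
        pivot ∃adm with x , adm , x-least ← least (u j) Admissible ∃adm =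
          s′ adm x-least , room′ adm x-least , door′ adm x-least

        -- If v j is not admissible, the door consists of the vertices v l, l ≢ k.
        stuck : ¬ ∃ Admissible → ∀ l → l ≢ k → s l ≡ v l
        stuck ∄adm = door-vertices
          where
          vertex? : ∀ y → Dec (∃ λ l → y ≡ v l)
          vertex? y = em

          -- Contrapositive of `v-min`: below a foreign vertex there are only vertices.
          vertex-below : ∀ {i y i′} → i′ ≢ i → u i y ≤ u i (v i′) → ∃ λ l → y ≡ v l
          vertex-below {i} {y} i′≢i le with vertex? y
          ... | yes w = w
          ... | no ∄l = contradiction le (<⇒≱ (v-min y (i′≢i ∘ sym) λ l eq → ∄l (l , eq)))

          -- If `s l` were a foreign vertex, every other point of the room would lie `l`-below it
          -- and so be a vertex, and never `v l`, which tops order `l`. Colour `l` would then be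
          -- missing from the room, which forces `l` to be the exempt colour `i₀`.
          vertex-at : ∀ l {i} → s l ≡ v i → i ≡ l
          vertex-at l {i} sl≡vi with i ≟ l
          ... | yes eq  = eq
          ... | no  i≢l = ⊥-elim (off-colour l≡i₀)
            where
            all-vertices : ∀ h → ∃ λ m → m ≢ l × s h ≡ v m
            all-vertices h with h ≟ l
            ... | yes refl = i , i≢l , sl≡vi
            ... | no  h≢l with vertex-below {l} i≢l (<⇒≤ (subst (λ y → u l (s h) < u l y) sl≡vi (maximal S l h h≢l)))
            ...   | m , eq = m , m≢l , eq
              where
              m≢l : m ≢ l
              m≢l refl = <⇒≱ (subst₂ (λ y z → u l y < u l z) eq sl≡vi (maximal S l h h≢l))
                           (<⇒≤ (v-max l (v i) (i≢l ∘ v-injective)))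
            c≢l : ∀ h → c (s h) ≢ l
            c≢l h eq with m , m≢l , eq′ ← all-vertices h = m≢l (trans (sym (c-v m)) (trans (cong c (sym eq′)) eq))
            l≡i₀ : l ≡ i₀
            l≡i₀ with l ≟ i₀
            ... | yes eq = eq
            ... | no neq with h , _ , eq ← onto F l neq = contradiction eq (c≢l h)
            -- In the exempt case `s k` is a vertex other than `v i₀`. Its colour occurs on the door
            -- too, on a point that is also a vertex, hence on the same vertex; this contradicts
            -- injectivity of the room.
            off-colour : l ≡ i₀ → ⊥
            off-colour refl with m , m≢l , eq ← all-vertices k with h , h≢k , eq′ ← onto F m m≢l
              with m′ , _ , eq″ ← all-vertices h =
              h≢k (injective S (trans eq″ (trans (cong v (trans (sym (c-v m′)) (trans (cong c (sym eq″)) eq′))) (sym eq))))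

          vertex-own : ∀ l → (∃ λ i → s l ≡ v i) → s l ≡ v l
          vertex-own l (i , eq) with refl ← vertex-at l eq = eq

          door-vertices : ∀ l → l ≢ k → s l ≡ v l
          door-vertices with em {s j ≡ v j}
          ... | yes sj≡vj = λ l l≢k → vertex-own l (vertex-below {k} j≢k (subst (λ y → u k (s l) ≤ u k y) sj≡vj (j-max l l≢k)))
          -- Were one of the bounds to fail for `v j`, the room's point at that bound would be a
          -- vertex, hence its own. At `j` this is excluded by the case, and `v l` is too large in
          -- order `l` to lie below `v j`.
          ... | no sj≢vj  = contradiction (v j , record { below-k = below-k″ ; below = below″ }) ∄adm
            where
            below-k″ : u k (v j) < u k (s j)
            below-k″ = ≰⇒> λ le → sj≢vj (vertex-own j (vertex-below j≢k le))
            below″ : ∀ l → l ≢ k → l ≢ j → u l (v j) < u l (s l)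
            below″ l l≢k l≢j = ≰⇒> λ le → <⇒≱
              (v-max l (v j) (l≢j ∘ sym ∘ v-injective))
              (subst (λ y → u l y ≤ u l (v j)) (vertex-own l (vertex-below (l≢j ∘ sym) le)) le)

      -- The door consists of all vertices but `v i₀`, so it has the required colours by `c-v`. The
      -- least remaining point in order `i₀` closes it to a room; that point is `v i₀` only if no
      -- non-vertex precedes it.
      start : ∃ λ s → Flag s i₀ × (∀ l → l ≢ i₀ → s l ≡ v l)
      start with least (u i₀) (λ y → ∀ l → l ≢ i₀ → y ≢ v l) (v i₀ , λ l l≢i₀ eq → l≢i₀ (sym (v-injective eq)))
      ... | x , x≢v , x-least = s , flag , s-v
        where
        s : I → Y
        s l with l ≟ i₀
        ... | yes _ = x
        ... | no  _ = v l
        s-x : s i₀ ≡ x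
        s-x with i₀ ≟ i₀
        ... | yes _  = refl
        ... | no neq = contradiction refl neq
        s-v : ∀ l → l ≢ i₀ → s l ≡ v l
        s-v l l≢i₀ with l ≟ i₀
        ... | yes eq = contradiction eq l≢i₀
        ... | no _   = refl
        v<x : ∀ b → b ≢ i₀ → u i₀ (v b) < u i₀ x
        v<x b b≢i₀ with em {x ≡ v i₀}
        ... | yes refl = v-max i₀ (v b) (b≢i₀ ∘ v-injective)
        ... | no x≢vi₀ = v-min x (b≢i₀ ∘ sym) not-vertex
          where
          not-vertex : ∀ l → x ≢ v l
          not-vertex l with l ≟ i₀
          ... | yes refl = x≢vi₀
          ... | no l≢i₀  = x≢v l l≢i₀
        maximal′ : ∀ a b → b ≢ a → u a (s b) < u a (s a)
        maximal′ a b b≢a with a ≟ i₀ | b ≟ i₀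
        ... | yes refl | yes refl = contradiction refl b≢a
        ... | yes refl | no b≢i₀  = v<x b b≢i₀
        ... | no a≢i₀  | yes refl = v-max a x (x≢v a a≢i₀)
        ... | no a≢i₀  | no _     = v-max a (v b) (b≢a ∘ v-injective)
        dominant′ : ∀ y → ∃ λ i → u i (s i) ≤ u i y
        dominant′ y with em {∃ λ l → l ≢ i₀ × y ≡ v l}
        ... | yes (l , l≢i₀ , refl) = l , ≤-reflexive (cong (u l) (s-v l l≢i₀))
        ... | no ∄l = i₀ , subst (λ z → u i₀ z ≤ u i₀ y) (sym s-x)
                             (x-least y λ l l≢i₀ eq → ∄l (l , l≢i₀ , eq))
        colour : ∀ l → l ≢ i₀ → c (s l) ≡ l
        colour l l≢i₀ = trans (cong c (s-v l l≢i₀)) (c-v l)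
        flag : Flag s i₀
        flag = record
          { room = record { maximal = maximal′ ; dominant = dominant′ }
          ; off  = λ l l≢i₀ → l≢i₀ ∘ trans (sym (colour l l≢i₀))
          ; onto = λ i i≢i₀ → i , i≢i₀ , colour i i≢i₀
          ; one  = λ {a} {b} a≢ b≢ eq → trans (sym (colour a a≢)) (trans eq (colour b b≢))
          }

      -- This door lies on the boundary. The new point of an adjacent room would be `i₀`-below the
      -- vertex `v k`, hence a vertex itself; but `v i₀` is too large and all other vertices are
      -- already in the door.
      start-isolated : ∀ {s s′ k} → (∀ l → l ≢ i₀ → s l ≡ v l) → Room s′ → ¬ SameDoor s i₀ s′ k
      start-isolated {s} {s′} {k} s-v R′ d = <⇒≱ y<vk (<⇒≤ (v-min (s′ k) (distinct d) not-vertex))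
        where
        s′-i₀ : s′ i₀ ≡ v k
        s′-i₀ = trans (sym (moved d)) (s-v k (distinct d ∘ sym))
        y<vk : u i₀ (s′ k) < u i₀ (v k)
        y<vk = subst (λ y → u i₀ (s′ k) < u i₀ y) s′-i₀ (maximal R′ i₀ k (distinct d ∘ sym))
        not-vertex : ∀ l → s′ k ≢ v l
        not-vertex l eq with l ≟ i₀ | l ≟ k
        ... | yes refl | _     = <⇒≱ (subst (λ y → u i₀ y < u i₀ (v k)) eq y<vk)
                                   (<⇒≤ (v-max i₀ (v k) (distinct d ∘ sym ∘ v-injective)))
        ... | no _ | yes refl  = distinct d (injective R′ (trans s′-i₀ (sym eq)))
        ... | no l≢i₀ | no l≢k = l≢k (injective R′ (trans (sym (kept d l l≢i₀ l≢k)) (trans (s-v l l≢i₀) (sym eq))))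

      -- A door of all vertices but `v k` lacks colour `k`, so `k` is the exempt colour; the room is
      -- then fixed by `room-determined`.
      start-unique : ∀ {s k t} → Flag s k → (∀ l → l ≢ k → s l ≡ v l) →
                     Flag t i₀ → (∀ l → l ≢ i₀ → t l ≡ v l) → k ≡ i₀ × (∀ l → s l ≡ t l)
      start-unique {s} {k} {t} F s-v G t-v with k ≟ i₀
      ... | no k≢i₀ with l , l≢k , eq ← onto F k k≢i₀ =
        contradiction (trans (sym (c-v l)) (trans (cong c (sym (s-v l l≢k))) eq)) l≢k
      ... | yes refl = refl , s≗t
        where
        agree : ∀ l → l ≢ k → s l ≡ t l
        agree l l≢k = trans (s-v l l≢k) (sym (t-v l l≢k))
        s≗t : ∀ l → s l ≡ t l
        s≗t l with l ≟ k
        ... | yes refl = room-determined k (room F) (room G) agree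
        ... | no l≢k   = agree l l≢k

      partner-door : ∀ {s k} → Flag s k → ¬ (∀ l → l ≢ k → s l ≡ v l) →
                     ∃₂ λ s′ j → Room s′ × SameDoor s k s′ j
      partner-door {s} {k} F ¬start with em {∃ (Pivot.Admissible F j≢k j-max)}
        where
        candidates : List I
        candidates = filter (λ l → ¬? (l ≟ k)) (paths n)
        -- The default of `argmax` must itself avoid `k`; this is the purpose of `other`.
        j : I
        j = argmax (u k ∘ s) (proj₁ (other k)) candidates
        j≢k : j ≢ k
        j≢k = argmax-all (u k ∘ s) {P = _≢ k} (proj₂ (other k)) (all-filter _ (paths n))
        j-max : ∀ l → l ≢ k → u k (s l) ≤ u k (s j)
        j-max l l≢k = All.lookup (f[xs]≤f[argmax] {f = u k ∘ s} _ candidates) (∈-filter⁺ _ (∈-paths l) l≢k)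
      ... | yes ∃adm with s′ , R′ , d ← Pivot.pivot F _ _ ∃adm = s′ , _ , R′ , d
      ... | no ∄adm  = contradiction (Pivot.stuck F _ _ ∄adm) ¬start

      IsFlag : Tree Y n × I → Set
      IsFlag (t , k) = Flag (at t) k

      -- Deduplicated because `points` may repeat entries, while the parity count needs each flag
      -- once.
      flags : List (Tree Y n × I)
      flags = deduplicate _≟_ (filter (λ x → em {IsFlag x}) (cartesianProduct (trees points n) (paths n)))

      flags-unique : Unique flags
      flags-unique = Unique.deduplicate-! _≟_ _

      ∈-flags : ∀ {x} → IsFlag x → x ∈ flags
      ∈-flags {t , k} F = ∈-deduplicate⁺ _≟_
        (∈-filter⁺ _ (∈-cartesianProduct⁺ (∈-trees t (∈-points ∘ at t)) (∈-paths k)) F)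

      ∈-flags⁻ : ∀ {x} → x ∈ flags → IsFlag x
      ∈-flags⁻ {x} x∈ = proj₂ (∈-filter⁻ (λ x → em {IsFlag x}) {xs = cartesianProduct (trees points n) (paths n)}
        (∈-deduplicate⁻ _≟_ _ x∈))

      record SwapPartners (x y : Tree Y n × I) : Set where
        constructor swapPartners
        field
          flagˡ  : IsFlag x
          flagʳ  : IsFlag y
          same   : proj₁ x ≡ proj₁ y
          moves  : proj₂ x ≢ proj₂ y
          colour : c (at (proj₁ x) (proj₂ x)) ≡ c (at (proj₁ y) (proj₂ y))

      record DoorPartners (x y : Tree Y n × I) : Set where
        constructor doorPartners
        field
          flagˡ : IsFlag x
          flagʳ : IsFlag y
          door  : SameDoor (at (proj₁ x)) (proj₂ x) (at (proj₁ y)) (proj₂ y)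

      Surjective : Set
      Surjective = ∃ λ s → Room s × (∀ i → ∃ λ j → c (s j) ≡ i)

      -- Without a room showing all colours, the omitted point of a flag repeats the colour of
      -- exactly one door point. The flag that omits that point instead is the partner.
      flags-even : ¬ Surjective → ∃ λ k → length flags ≡ k + k
      flags-even ¬surj = matching⇒even SwapPartners
        (λ p → SwapPartners.moves p refl)
        (λ { (swapPartners F G refl neq eq) → swapPartners G F refl (neq ∘ sym) (sym eq) })
        (λ { (swapPartners F _ refl neq eq) (swapPartners _ _ refl neq′ eq′) →
               cong (_ ,_) (one F (neq ∘ sym) (neq′ ∘ sym) (trans (sym eq) eq′)) })
        flags flags-unique partner
        where
        partner : ∀ {x} → x ∈ flags → ∃ λ y → y ∈ flags × SwapPartners x y
        partner {t , k} x∈ with F ← ∈-flags⁻ x∈ with c (at t k) ≟ i₀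
        ... | no neq with j , j≢k , eq ← onto F _ neq =
          (t , j) , ∈-flags (swap F j≢k eq) , swapPartners F (swap F j≢k eq) refl (j≢k ∘ sym) (sym eq)
        ... | yes eq = contradiction (at t , room F , surj) ¬surj
          where
          surj : ∀ i → ∃ λ j → c (at t j) ≡ i
          surj i with i ≟ i₀
          ... | yes refl = k , eq
          ... | no i≢i₀ with j , _ , eq ← onto F i i≢i₀ = j , eq

      -- Crossing the door matches all flags except the starting one, which has no room on the other
      -- side.
      flags-odd : ∃ λ k → length flags ≡ suc (k + k)
      flags-odd with s , F , s-v ← start = odd
        where
        t₀ : Tree Y n
        t₀ = tabulate s
        t₀-v : ∀ l → l ≢ i₀ → at t₀ l ≡ v l
        t₀-v l l≢i₀ = trans (at-tabulate s l) (s-v l l≢i₀)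
        F₀ : IsFlag (t₀ , i₀)
        F₀ = flag-resp (sym ∘ at-tabulate s) F
        isolated : ∀ {y} → ¬ DoorPartners (t₀ , i₀) y
        isolated (doorPartners _ G d) = start-isolated t₀-v (room G) d
        fun : ∀ {x y z} → DoorPartners x y → DoorPartners x z → y ≡ z
        fun (doorPartners _ F d) (doorPartners _ G e)
          with refl ← sameDoor-index (room F) (room G) d e =
          cong (_, _) (at-ext _ _ (sameDoor-room (room F) (room G) d e))
        irrefl : ∀ {x} → ¬ DoorPartners x x
        irrefl (doorPartners _ _ d) = distinct d refl
        symm : ∀ {x y} → DoorPartners x y → DoorPartners y x
        symm (doorPartners F G d) = doorPartners G F (sameDoor-sym d)
        not-start : ∀ {t k} → (t , k) ≢ (t₀ , i₀) → Flag (at t) k → ¬ (∀ l → l ≢ k → at t l ≡ v l)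
        not-start neq F t-v with refl , eq ← start-unique F t-v F₀ t₀-v = neq (cong (_, i₀) (at-ext _ _ eq))
        partner : ∀ {x} → x ≢ (t₀ , i₀) → IsFlag x → ∃ λ y → y ∈ flags × DoorPartners x y
        partner {t , k} neq F with s′ , j , R′ , d ← partner-door F (not-start neq F) =
          (tabulate s′ , j) , ∈-flags G , doorPartners F G d′
          where
          G : IsFlag (tabulate s′ , j)
          G = flag-resp (sym ∘ at-tabulate s′) (sameDoor-flag F R′ d)
          d′ : SameDoor (at t) k (at (tabulate s′)) j
          d′ = record
            { distinct = distinct d
            ; moved    = trans (moved d) (sym (at-tabulate s′ k))
            ; kept     = λ l l≢k l≢j → trans (kept d l l≢k l≢j) (sym (at-tabulate s′ l))
            }
        not-isolated : ∀ {ys x y} → flags ↭ (t₀ , i₀) ∷ ys → y ∈ flags → DoorPartners x y → y ∈ ys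
        not-isolated p y∈ d with ∈-resp-↭ p y∈
        ... | here refl  = contradiction (symm d) isolated
        ... | there y∈ys = y∈ys
        rest-even : ∀ {ys} → flags ↭ (t₀ , i₀) ∷ ys → Unique ((t₀ , i₀) ∷ ys) → ∃ λ k → length ys ≡ k + k
        rest-even {ys} p (x∉ys ∷ uniq) = matching⇒even DoorPartners irrefl symm fun ys uniq λ x∈ys →
          let y , y∈ , d = partner (All.lookup x∉ys x∈ys ∘ sym) (∈-flags⁻ (∈-resp-↭ (↭-sym p) (there x∈ys)))
          in y , not-isolated p y∈ d , d
        odd : ∃ λ k → length flags ≡ suc (k + k)
        odd = let ys , p = ∈⇒↭ (∈-flags F₀)
                  k , eq = rest-even p (Unique-resp-↭ p flags-unique)
              in k , trans (↭-length p) (cong suc eq)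

      abstract
        panchromatic-room : ∃ λ s → Room s × (∀ i → ∃ λ j → c (s j) ≡ i)
        panchromatic-room with em {Surjective}
        ... | yes surj = surj
        ... | no ¬surj with k , even ← flags-even ¬surj with l , odd ← flags-odd =
          contradiction (trans (sym even) odd) (double≢1+double k l)

-- Rational estimates

/-mono-≤ : ∀ a b d e .{{_ : NonZero d}} .{{_ : NonZero e}} →
           a * e ≤ b * d → + a / d ℚ.≤ + b / e
/-mono-≤ a b (suc d) (suc e) h = ℚ.toℚᵘ-cancel-≤ $ begin
  toℚᵘ (+ a / suc d)  ≃⟨ ℚ.toℚᵘ-fromℚᵘ (ℚᵘ.mkℚᵘ (+ a) d) ⟩
  ℚᵘ.mkℚᵘ (+ a) d     ≤⟨ ℚᵘ.*≤* (subst₂ ℤ._≤_ (ℤ.pos-* a (suc e)) (ℤ.pos-* b (suc d)) (ℤ.+≤+ h)) ⟩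
  ℚᵘ.mkℚᵘ (+ b) e     ≃⟨ ℚ.toℚᵘ-fromℚᵘ (ℚᵘ.mkℚᵘ (+ b) e) ⟨
  toℚᵘ (+ b / suc e)  ∎
  where open ℚᵘ.≤-Reasoning

/-mono-< : ∀ a b d e .{{_ : NonZero d}} .{{_ : NonZero e}} →
           a * e < b * d → + a / d ℚ.< + b / e
/-mono-< a b (suc d) (suc e) h = ℚ.toℚᵘ-cancel-< $ begin-strict
  toℚᵘ (+ a / suc d)  ≃⟨ ℚ.toℚᵘ-fromℚᵘ (ℚᵘ.mkℚᵘ (+ a) d) ⟩
  ℚᵘ.mkℚᵘ (+ a) d     <⟨ ℚᵘ.*<* (subst₂ ℤ._<_ (ℤ.pos-* a (suc e)) (ℤ.pos-* b (suc d)) (ℤ.+<+ h)) ⟩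
  ℚᵘ.mkℚᵘ (+ b) e     ≃⟨ ℚ.toℚᵘ-fromℚᵘ (ℚᵘ.mkℚᵘ (+ b) e) ⟨
  toℚᵘ (+ b / suc e)  ∎
  where open ℚᵘ.≤-Reasoning

/-homo-+ : ∀ a b d .{{_ : NonZero d}} → + (a + b) / d ≡ + a / d ℚ.+ + b / d
/-homo-+ a b (suc d) = ℚ.toℚᵘ-injective $ begin-equality
  toℚᵘ (+ (a + b) / suc d)                    ≃⟨ ℚ.toℚᵘ-fromℚᵘ (ℚᵘ.mkℚᵘ (+ (a + b)) d) ⟩
  ℚᵘ.mkℚᵘ (+ (a + b)) d                       ≃⟨ ℚᵘ.*≡* (ident (+ a) (+ b) (+ suc d)) ⟩
  ℚᵘ.mkℚᵘ (+ a) d ℚᵘ.+ ℚᵘ.mkℚᵘ (+ b) d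
    ≃⟨ ℚᵘ.+-cong (ℚ.toℚᵘ-fromℚᵘ (ℚᵘ.mkℚᵘ (+ a) d)) (ℚ.toℚᵘ-fromℚᵘ (ℚᵘ.mkℚᵘ (+ b) d)) ⟨
  toℚᵘ (+ a / suc d) ℚᵘ.+ toℚᵘ (+ b / suc d)  ≃⟨ ℚ.toℚᵘ-homo-+ (+ a / suc d) (+ b / suc d) ⟨
  toℚᵘ (+ a / suc d ℚ.+ + b / suc d)          ∎
  where
  open ℚᵘ.≤-Reasoning
  ident : ∀ a b d → (a ℤ.+ b) ℤ.* (d ℤ.* d) ≡ (a ℤ.* d ℤ.+ b ℤ.* d) ℤ.* d
  ident = ℤ-Solver.solve-∀

-- Masses on binary trees

-- Below a leaf the whole mass follows the zeros, so that a finite tree gives a measure on all of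
-- Cantor space.
mass : ∀ {n} → Tree ℕ n → Str → ℕ
mass (leaf a)   []          = a
mass (leaf a)   (false ∷ σ) = mass (leaf a) σ
mass (leaf a)   (true  ∷ σ) = 0
mass (node l r) []          = mass l [] + mass r []
mass (node l r) (false ∷ σ) = mass l σ
mass (node l r) (true  ∷ σ) = mass r σ

mass-additive : ∀ {n} (t : Tree ℕ n) σ → mass t σ ≡ mass t (σ ∷ʳ false) + mass t (σ ∷ʳ true)
mass-additive (leaf a)   []          = sym (+-identityʳ a)
mass-additive (leaf a)   (false ∷ σ) = mass-additive (leaf a) σ
mass-additive (leaf a)   (true  ∷ σ) = refl
mass-additive (node l r) []          = refl
mass-additive (node l r) (false ∷ σ) = mass-additive l σ
mass-additive (node l r) (true  ∷ σ) = mass-additive r σ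

mass≤total : ∀ {n} (t : Tree ℕ n) σ → mass t σ ≤ mass t []
mass≤total (leaf a)   []          = ≤-refl
mass≤total (leaf a)   (false ∷ σ) = mass≤total (leaf a) σ
mass≤total (leaf a)   (true  ∷ σ) = z≤n
mass≤total (node l r) []          = ≤-refl
mass≤total (node l r) (false ∷ σ) = ≤-trans (mass≤total l σ) (m≤m+n _ _)
mass≤total (node l r) (true  ∷ σ) = ≤-trans (mass≤total r σ) (m≤n+m _ _)

at≤total : ∀ {n} (t : Tree ℕ n) p → at t p ≤ mass t []
at≤total (leaf a)   []          = ≤-refl
at≤total (node l r) (false ∷ p) = ≤-trans (at≤total l p) (m≤m+n _ _)
at≤total (node l r) (true  ∷ p) = ≤-trans (at≤total r p) (m≤n+m _ _)

infix 4 _≤ₜ_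
_≤ₜ_ : ∀ {n} → Tree ℕ n → Tree ℕ n → Set
s ≤ₜ t = ∀ p → at s p ≤ at t p

mass-mono : ∀ {n} (s t : Tree ℕ n) → s ≤ₜ t → ∀ σ → mass s σ ≤ mass t σ
mass-mono (leaf a)   (leaf b)     le []          = le []
mass-mono (leaf a)   (leaf b)     le (false ∷ σ) = mass-mono (leaf a) (leaf b) le σ
mass-mono (leaf a)   (leaf b)     le (true  ∷ σ) = z≤n
mass-mono (node l r) (node l′ r′) le []          =
  +-mono-≤ (mass-mono l l′ (le ∘ (false ∷_)) []) (mass-mono r r′ (le ∘ (true ∷_)) [])
mass-mono (node l r) (node l′ r′) le (false ∷ σ) = mass-mono l l′ (le ∘ (false ∷_)) σ
mass-mono (node l r) (node l′ r′) le (true  ∷ σ) = mass-mono r r′ (le ∘ (true ∷_)) σ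

cancel-≤ : ∀ {a b c d k} → a ≤ b → b + d ≤ a + c + k → d ≤ c + k
cancel-≤ {a} {b} {c} {d} {k} a≤b h = +-cancelˡ-≤ a _ _ (begin
  a + d        ≤⟨ +-monoˡ-≤ d a≤b ⟩
  b + d        ≤⟨ h ⟩
  a + c + k    ≡⟨ +-assoc a c k ⟩
  a + (c + k)  ∎)
  where open ≤-Reasoning

-- The excess of `t` over `s` is nonnegative at every leaf, so no cylinder carries more of it than
-- the total.
mass-gap : ∀ {n} (s t : Tree ℕ n) {k} → s ≤ₜ t → mass t [] ≤ mass s [] + k →
           ∀ σ → mass t σ ≤ mass s σ + k
mass-gap s            t            le gap []          = gap
mass-gap (leaf a)     (leaf b)     le gap (false ∷ σ) = mass-gap (leaf a) (leaf b) le gap σ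
mass-gap (leaf a)     (leaf b)     le gap (true  ∷ σ) = z≤n
mass-gap (node l r)   (node l′ r′) {k} le gap (false ∷ σ) =
  mass-gap l l′ (le ∘ (false ∷_))
    (cancel-≤ (mass-mono r r′ (le ∘ (true ∷_)) [])
      (subst₂ (λ x y → x ≤ y + k) (+-comm (mass l′ []) _) (+-comm (mass l []) _) gap)) σ
mass-gap (node l r)   (node l′ r′) le gap (true  ∷ σ) =
  mass-gap r r′ (le ∘ (true ∷_)) (cancel-≤ (mass-mono l l′ (le ∘ (false ∷_)) []) gap) σ

mass-suc : ∀ {n} (s t : Tree ℕ n) → (∀ p → at t p ≡ suc (at s p)) → mass t [] ≡ mass s [] + 2 ^ n
mass-suc (leaf a)   (leaf b)     eq = trans (eq []) (+-comm 1 a)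
mass-suc (node {n} l r) (node l′ r′) eq =
  trans (cong₂ _+_ (mass-suc l l′ (eq ∘ (false ∷_))) (mass-suc r r′ (eq ∘ (true ∷_))))
        (ident (mass l []) (mass r []) (2 ^ n))
  where
  ident : ∀ a b k → a + k + (b + k) ≡ a + b + 2 * k
  ident = solve-∀

-- The left subtree is filled as far as possible and the right one takes the remainder.
shrink : ∀ {n} (t : Tree ℕ n) m → m ≤ mass t [] → ∃ λ s → s ≤ₜ t × mass s [] ≡ m
shrink (leaf a)   m m≤a = leaf m , (λ { [] → m≤a }) , refl
shrink (node l r) m m≤t
  with s₁ , s₁≤l , eq₁ ← shrink l (mass l [] ⊓ m) (m⊓n≤m _ _)
     | s₂ , s₂≤r , eq₂ ← shrink r (m ∸ mass l []) (m≤n+o⇒m∸n≤o m (mass l []) m≤t) =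
  node s₁ s₂
  , (λ { (false ∷ p) → s₁≤l p ; (true ∷ p) → s₂≤r p })
  , trans (cong₂ _+_ eq₁ eq₂) (m⊓n+n∸m≡n (mass l []) m)

spike : ∀ {n} → ℕ → Path n → Tree ℕ n
spike m []          = leaf m
spike m (false ∷ p) = node (spike m p) (spike 0 p)
spike m (true  ∷ p) = node (spike 0 p) (spike m p)

spike-total : ∀ {n} m (p : Path n) → mass (spike m p) [] ≡ m
spike-total m []          = refl
spike-total m (false ∷ p) = trans (cong₂ _+_ (spike-total m p) (spike-total 0 p)) (+-identityʳ m)
spike-total m (true  ∷ p) = cong₂ _+_ (spike-total 0 p) (spike-total m p)

spike-at : ∀ {n} m (p : Path n) → at (spike m p) p ≡ m
spike-at m []          = refl
spike-at m (false ∷ p) = spike-at m p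
spike-at m (true  ∷ p) = spike-at m p

spike-0 : ∀ {n} (p q : Path n) → at (spike 0 p) q ≡ 0
spike-0 p q = n≤0⇒n≡0 (subst (at (spike 0 p) q ≤_) (spike-total 0 p) (at≤total (spike 0 p) q))

spike-off : ∀ {n} m (p q : Path n) → p ≢ q → at (spike m p) q ≡ 0
spike-off m []          []          neq = contradiction refl neq
spike-off m (false ∷ p) (false ∷ q) neq = spike-off m p q (neq ∘ cong (false ∷_))
spike-off m (false ∷ p) (true  ∷ q) neq = spike-0 p q
spike-off m (true  ∷ p) (false ∷ q) neq = spike-0 p q
spike-off m (true  ∷ p) (true  ∷ q) neq = spike-off m p q (neq ∘ cong (true ∷_))

spike-unique : ∀ {n} {m} (t : Tree ℕ n) p → mass t [] ≡ m → m ≤ at t p → t ≡ spike m p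
spike-unique (leaf a)   []          refl _ = refl
spike-unique (node l r) (false ∷ p) refl le =
  cong₂ node
    (trans (spike-unique l p refl (≤-trans (m≤m+n _ _) le)) (cong (λ m → spike m p) (sym total≡)))
    (spike-unique r p r≡0 z≤n)
  where
  r≡0 : mass r [] ≡ 0
  r≡0 = n≤0⇒n≡0 (+-cancelˡ-≤ (mass l []) _ _
    (≤-trans le (≤-trans (at≤total l p) (≤-reflexive (sym (+-identityʳ _))))))
  total≡ : mass l [] + mass r [] ≡ mass l []
  total≡ = trans (cong (λ x → mass l [] + x) r≡0) (+-identityʳ _)
spike-unique (node l r) (true ∷ p) refl le =
  cong₂ node
    (spike-unique l p l≡0 z≤n)
    (trans (spike-unique r p refl (≤-trans (m≤n+m _ _) le))
           (cong (λ m → spike m p) (sym (cong (λ x → x + mass r []) l≡0))))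
  where
  l≡0 : mass l [] ≡ 0
  l≡0 = n≤0⇒n≡0 (+-cancelʳ-≤ (mass r []) _ _ (≤-trans le (at≤total r p)))

-- Grid points, dyadic scaling and dominated branches

Grid : ℕ → ℕ → Set
Grid n m = ∃ λ (t : Tree ℕ n) → mass t [] ≡ m

grid-ext : ∀ {n m} {x y : Grid n m} → proj₁ x ≡ proj₁ y → x ≡ y
grid-ext {x = t , p} {.t , q} refl = cong (t ,_) (≡-irrelevant p q)

data _⊑_ : ∀ {n} → Str → Path n → Set where
  []  : ∀ {n} {p : Path n} → [] ⊑ p
  _∷_ : ∀ {n} b {σ} {p : Path n} → σ ⊑ p → (b ∷ σ) ⊑ (b ∷ p)

extension : ∀ {n} σ → length σ ≤ n → ∃ λ (p : Path n) → σ ⊑ p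
extension {n}     []      _       = replicate n false , []
extension {suc n} (b ∷ σ) (s≤s l) with p , σ⊑p ← extension σ l = b ∷ p , b ∷ σ⊑p

ℚ-cancel-≤ : ∀ {a b c d} → a ℚ.≤ b → b ℚ.+ d ℚ.≤ a ℚ.+ c → d ℚ.≤ c
ℚ-cancel-≤ a≤b h = ℚ.≮⇒≥ λ c<d → ℚ.<-irrefl refl (ℚ.<-≤-trans (ℚ.+-mono-≤-< a≤b c<d) h)

n<2^n : ∀ n → n < 2 ^ n
n<2^n zero    = s≤s z≤n
n<2^n (suc n) = begin-strict
  suc n          ≤⟨ n<2^n n ⟩
  2 ^ n          <⟨ m<m+n (2 ^ n) (≤-trans (m^n>0 2 n) (m≤m+n (2 ^ n) 0)) ⟩
  2 ^ suc n      ∎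
  where open ≤-Reasoning

abstract
  scale : ℕ → ℕ → ℚ
  scale k a = _/_ (+ a) (2 ^ k) {{m^n≢0 2 k}}

  scale-dyadic : ∀ k a → IsDyadic (scale k a)
  scale-dyadic k a = a , k , refl

  scale-mono-≤ : ∀ k {a b} → a ≤ b → scale k a ℚ.≤ scale k b
  scale-mono-≤ k {a} {b} a≤b = /-mono-≤ a b (2 ^ k) (2 ^ k) {{m^n≢0 2 k}} {{m^n≢0 2 k}} (*-monoˡ-≤ (2 ^ k) a≤b)

  scale-+ : ∀ k a b → scale k (a + b) ≡ scale k a ℚ.+ scale k b
  scale-+ k a b = /-homo-+ a b (2 ^ k) {{m^n≢0 2 k}}

  scale-0 : ∀ k → scale k 0 ≡ 0ℚ
  scale-0 k = ℚ.0/n≡0 (2 ^ k) {{m^n≢0 2 k}}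

  scale-1 : ∀ k → scale k (2 ^ k) ≡ 1ℚ
  scale-1 k = ℚ.≤-antisym
    (/-mono-≤ (2 ^ k) 1 (2 ^ k) 1 {{m^n≢0 2 k}} (≤-reflexive (*-comm (2 ^ k) 1)))
    (/-mono-≤ 1 (2 ^ k) 1 (2 ^ k) {{_}} {{m^n≢0 2 k}} (≤-reflexive (*-comm 1 (2 ^ k))))

  scale-mono-< : ∀ k {a b} → a < b → scale k a ℚ.< scale k b
  scale-mono-< k {a} {b} a<b = /-mono-< a b (2 ^ k) (2 ^ k) {{m^n≢0 2 k}} {{m^n≢0 2 k}}
    (*-monoˡ-< (2 ^ k) {{m^n≢0 2 k}} a<b)

  2/1+<scale : ∀ k → 2/1+ (2 * 2 ^ k) ℚ.< scale k 1
  2/1+<scale k = /-mono-< 2 1 (suc (2 * 2 ^ k)) (2 ^ k) {{_}} {{m^n≢0 2 k}}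
    (≤-reflexive (sym (*-identityˡ (suc (2 * 2 ^ k)))))

  -- A tolerance of one unit per leaf uses up one factor `2 ^ d` of the denominator; the other
  -- factor makes the quotient small.
  scale≤1/1+ : ∀ d n → n < 2 ^ d → scale (d + d) (2 ^ d) ℚ.≤ 1/1+ n
  scale≤1/1+ d n n<2^d = /-mono-≤ (2 ^ d) 1 (2 ^ (d + d)) (suc n) {{m^n≢0 2 (d + d)}} (begin
    2 ^ d * suc n    ≤⟨ *-monoʳ-≤ (2 ^ d) n<2^d ⟩
    2 ^ d * 2 ^ d    ≡⟨ ^-distribˡ-+-* 2 d d ⟨
    2 ^ (d + d)      ≡⟨ *-identityˡ _ ⟨
    1 * 2 ^ (d + d)  ∎)
    where open ≤-Reasoning

-- At a node of positive mass where a semimeasure lies below the mass, the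
-- same holds at one of the two children; so it holds along a whole branch.
dominated-branch : ∀ k {n} (t : Tree ℕ n) (g : Str → ℚ) →
  (∀ σ → 0ℚ ℚ.≤ g σ) →
  (∀ σ → g (σ ∷ʳ false) ℚ.+ g (σ ∷ʳ true) ℚ.≤ g σ) →
  g [] ℚ.≤ scale k (mass t []) → 0 < mass t [] →
  ∃ λ p → 0 < at t p × (∀ σ → σ ⊑ p → g σ ℚ.≤ scale k (mass t σ))
dominated-branch k (leaf a)   g g≥0 sup le pos = [] , pos , λ { [] [] → le }
dominated-branch k (node l r) g g≥0 sup le pos = choose (0 <? mass l []) (gl ℚ.≤? scale k (mass l []))
  where
  gl gr : ℚ
  gl = g (false ∷ [])
  gr = g (true ∷ [])

  children : gl ℚ.+ gr ℚ.≤ scale k (mass l []) ℚ.+ scale k (mass r [])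
  children = ℚ.≤-trans (sup []) (ℚ.≤-trans le (ℚ.≤-reflexive (scale-+ k (mass l []) (mass r []))))

  Goal : Set
  Goal = ∃ λ p → 0 < at (node l r) p × (∀ σ → σ ⊑ p → g σ ℚ.≤ scale k (mass (node l r) σ))

  right : scale k (mass l []) ℚ.≤ gl → 0 < mass r [] → Goal
  right l≤gl r>0
    with p , p>0 , h ← dominated-branch k r (g ∘ (true ∷_)) (g≥0 ∘ (true ∷_)) (sup ∘ (true ∷_))
                         (ℚ-cancel-≤ l≤gl children) r>0 =
    true ∷ p , p>0 , λ { [] [] → le ; (true ∷ σ) (_ ∷ σ⊑p) → h σ σ⊑p }

  choose : Dec (0 < mass l []) → Dec (gl ℚ.≤ scale k (mass l [])) → Goal
  choose (yes l>0) (yes gl≤)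
    with p , p>0 , h ← dominated-branch k l (g ∘ (false ∷_)) (g≥0 ∘ (false ∷_)) (sup ∘ (false ∷_)) gl≤ l>0 =
    false ∷ p , p>0 , λ { [] [] → le ; (false ∷ σ) (_ ∷ σ⊑p) → h σ σ⊑p }
  -- When the left child fails, the surplus there lets the right child succeed. A massless right
  -- child is impossible: the left mass would be the whole mass and bound `gl`.
  choose (yes l>0) (no gl≰) = right (ℚ.<⇒≤ (ℚ.≰⇒> gl≰)) (n≢0⇒n>0 r≢0)
    where
    r≢0 : mass r [] ≢ 0
    r≢0 r≡0 = gl≰ (begin
      gl                                           ≡⟨ ℚ.+-identityʳ gl ⟨
      gl ℚ.+ 0ℚ                                    ≤⟨ ℚ.+-monoʳ-≤ gl (g≥0 _) ⟩
      gl ℚ.+ gr                                    ≤⟨ children ⟩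
      scale k (mass l []) ℚ.+ scale k (mass r [])  ≡⟨ cong (λ x → scale k (mass l []) ℚ.+ scale k x) r≡0 ⟩
      scale k (mass l []) ℚ.+ scale k 0            ≡⟨ cong (scale k (mass l []) ℚ.+_) (scale-0 k) ⟩
      scale k (mass l []) ℚ.+ 0ℚ                   ≡⟨ ℚ.+-identityʳ _ ⟩
      scale k (mass l [])                          ∎)
      where open ℚ.≤-Reasoning
  choose (no l≯0) _ = right
    (ℚ.≤-trans (ℚ.≤-reflexive (trans (cong (scale k) l≡0) (scale-0 k))) (g≥0 _))
    (subst (λ x → 0 < x + mass r []) l≡0 pos)
    where
    l≡0 : mass l [] ≡ 0
    l≡0 = n≤0⇒n≡0 (≮⇒≥ l≯0)

lex-< : ∀ {q q′ r r′ K} → q < q′ → r < K → q * K + r < q′ * K + r′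
lex-< {q} {q′} {r} {r′} {K} q<q′ r<K = begin-strict
  q * K + r    <⟨ +-monoʳ-< (q * K) r<K ⟩
  q * K + K    ≡⟨ +-comm (q * K) K ⟩
  suc q * K    ≤⟨ *-monoˡ-≤ K q<q′ ⟩
  q′ * K       ≤⟨ m≤m+n _ r′ ⟩
  q′ * K + r′  ∎
  where open ≤-Reasoning

-- Linear orders on the grid and tight clusters

module Grids (em : ExcludedMiddle 0ℓ) where
  open Classical em

  witnesses : {A : Set} (P : A → Set) → List A → List (∃ P)
  witnesses P []       = []
  witnesses P (x ∷ xs) with em {P x}
  ... | yes px = (x , px) ∷ witnesses P xs
  ... | no _   = witnesses P xs

  ∈-witnesses : {A : Set} {P : A → Set} → (∀ {x} (p q : P x) → p ≡ q) →
                ∀ {x xs} → x ∈ xs → (px : P x) → (x , px) ∈ witnesses P xs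
  ∈-witnesses {P = P} irr {x} (here refl) px with em {P x}
  ... | yes px′ = here (cong (x ,_) (irr px px′))
  ... | no ¬px  = contradiction px ¬px
  ∈-witnesses {P = P} irr {xs = y ∷ _} (there x∈xs) px with em {P y}
  ... | yes _ = there (∈-witnesses irr x∈xs px)
  ... | no _  = ∈-witnesses irr x∈xs px

  module _ (d k : ℕ) where
    private
      m n : ℕ
      m = 2 ^ k
      n = suc d

    grid : List (Grid n m)
    grid = witnesses (λ t → mass t [] ≡ m) (trees (upTo (suc m)) n)

    ∈-grid : ∀ x → x ∈ grid
    ∈-grid (t , t≡m) = ∈-witnesses ≡-irrelevant
      (∈-trees t λ p → ∈-upTo⁺ (s≤s (subst (at t p ≤_) t≡m (at≤total t p)))) t≡m

    vertex : Path n → Grid n m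
    vertex p = spike m p , spike-total m p

    coord : Path n → Grid n m → ℕ
    coord i x = at (proj₁ x) i

    tie : Grid n m → ℕ
    tie x with em {∃ λ l → x ≡ vertex l}
    ... | yes _ = 0
    ... | no _  = 1

    tie≤1 : ∀ x → tie x ≤ 1
    tie≤1 x with em {∃ λ l → x ≡ vertex l}
    ... | yes _ = z≤n
    ... | no _  = ≤-refl

    tie-vertex : ∀ l → tie (vertex l) ≡ 0
    tie-vertex l with em {∃ λ l′ → vertex l ≡ vertex l′}
    ... | yes _  = refl
    ... | no ∄l′ = contradiction (l , refl) ∄l′

    tie-nonvertex : ∀ {x} → (∀ l → x ≢ vertex l) → tie x ≡ 1
    tie-nonvertex {x} x≢v with em {∃ λ l → x ≡ vertex l}
    ... | yes (l , eq) = contradiction eq (x≢v l)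
    ... | no _         = refl

    code : Grid n m → ℕ
    code x = toℕ (index (∈-grid x))

    code<length : ∀ x → code x < length grid
    code<length x = toℕ<n (index (∈-grid x))

    code-injective : ∀ {x y} → code x ≡ code y → x ≡ y
    code-injective {x} {y} eq = trans (lookup-index (∈-grid x))
      (trans (cong (lookup grid) (toℕ-injective eq)) (sym (lookup-index (∈-grid y))))

    -- Among points with the same coordinate the vertices come first, as
    -- vertex-min requires.
    level : Path n → Grid n m → ℕ
    level i x = coord i x + coord i x + tie x

    -- Scarf's argument needs linear orders, so points of equal level are separated by their
    -- position in the list.
    rank : Path n → Grid n m → ℕ
    rank i x = level i x * length grid + code x

    level<⇒rank< : ∀ i {x y} → level i x < level i y → rank i x < rank i y
    level<⇒rank< i {x} lt = lex-< lt (code<length x)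

    coord<⇒level< : ∀ i {x y} → coord i x < coord i y → level i x < level i y
    coord<⇒level< i {x} {y} lt = begin-strict
      a + a + tie x  ≤⟨ +-monoʳ-≤ (a + a) (tie≤1 x) ⟩
      a + a + 1      ≡⟨ +-comm (a + a) 1 ⟩
      suc a + a      <⟨ +-mono-≤-< lt lt ⟩
      b + b          ≤⟨ m≤m+n (b + b) (tie y) ⟩
      b + b + tie y  ∎
      where
      open ≤-Reasoning
      a = coord i x
      b = coord i y

    coord<⇒rank< : ∀ i {x y} → coord i x < coord i y → rank i x < rank i y
    coord<⇒rank< i {x} {y} = level<⇒rank< i {x} {y} ∘ coord<⇒level< i {x} {y}

    rank≤⇒coord≤ : ∀ i {x y} → rank i x ≤ rank i y → coord i x ≤ coord i y
    rank≤⇒coord≤ i {x} {y} le = ≮⇒≥ λ lt → <⇒≱ (coord<⇒rank< i {y} {x} lt) le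

    rank-injective : ∀ i {x y} → rank i x ≡ rank i y → x ≡ y
    rank-injective i {x} {y} eq = code-injective
      (+-cancelˡ-≡ (level i x * length grid) _ _ (trans eq (cong (λ q → q * length grid + code y) (sym level≡))))
      where
      level≡ : level i x ≡ level i y
      level≡ = ≤-antisym
        (≮⇒≥ λ lt → <⇒≢ (level<⇒rank< i {y} {x} lt) (sym eq))
        (≮⇒≥ λ lt → <⇒≢ (level<⇒rank< i {x} {y} lt) eq)

    vertex-max : ∀ i y → y ≢ vertex i → rank i y < rank i (vertex i)
    vertex-max i (t , t≡m) y≢v = coord<⇒rank< i {t , t≡m} {vertex i}
      (subst (λ a → at t i < a) (sym (spike-at m i))
        (≰⇒> λ le → y≢v (grid-ext (spike-unique t i t≡m le))))

    vertex-min : ∀ {i j} y → i ≢ j → (∀ l → y ≢ vertex l) → rank i (vertex j) < rank i y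
    vertex-min {i} {j} y i≢j y≢v = level<⇒rank< i {vertex j} {y} (begin-strict
      level i (vertex j)           ≡⟨ cong₂ (λ a b → a + a + b) (spike-off m j i (i≢j ∘ sym)) (tie-vertex j) ⟩
      0                            <⟨ s≤s z≤n ⟩
      1                            ≡⟨ tie-nonvertex y≢v ⟨
      tie y                        ≤⟨ m≤n+m (tie y) _ ⟩
      level i y                    ∎)
      where open ≤-Reasoning

    -- The depth is `suc d` so that every leaf has another one to serve as `other`.
    flip : Path n → Path n
    flip (b ∷ p) = not b ∷ p

    flip≢ : ∀ p → flip p ≢ p
    flip≢ (false ∷ p) ()
    flip≢ (true  ∷ p) ()

    module _ (S : Grid n m → B) where

      abstract
        branch : ∀ x → ∃ λ p → 0 < coord p x ×
                 (∀ σ → σ ⊑ p → B.val (S x) σ ℚ.≤ scale k (mass (proj₁ x) σ))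
        branch x@(t , t≡m) = dominated-branch k t (B.val (S x)) (B.val≥0 (S x)) (B.superadditive (S x))
          (ℚ.≤-reflexive (trans (B.total (S x)) (sym (trans (cong (scale k) t≡m) (scale-1 k)))))
          (subst (0 <_) (sym t≡m) (m^n>0 2 k))

      colour : Grid n m → Path n
      colour x = proj₁ (branch x)

      colour-vertex : ∀ i → colour (vertex i) ≡ i
      colour-vertex i with em {i ≡ colour (vertex i)}
      ... | yes eq = sym eq
      ... | no neq = contradiction (spike-off m i _ neq) (m<n⇒n≢0 (proj₁ (proj₂ (branch (vertex i)))))

      open KKM grid ∈-grid rank rank-injective vertex vertex-max vertex-min colour colour-vertex
        (λ i → flip i , flip≢ i)

      Close-points : ℕ → Set
      Close-points e = ∃ λ (x : Grid n m) → ∀ σ → length σ ≤ n → ∃ λ (y : Grid n m) →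
        (∀ τ → mass (proj₁ x) τ ≤ mass (proj₁ y) τ + e × mass (proj₁ y) τ ≤ mass (proj₁ x) τ + e) ×
        B.val (S y) σ ℚ.≤ scale k (mass (proj₁ y) σ)

      -- All points of the room lie leafwise below `peak` and have total `m`, while `peak` has total
      -- less than `m + 2 ^ n`. Hence on each cylinder they all lie within `2 ^ n` below `peak`, and
      -- any of them can be the centre.
      room⇒close-points : ∀ e → 2 ^ n ≤ e → ∃ (λ s → Room s × (∀ i → ∃ λ j → colour (s j) ≡ i)) → Close-points e
      room⇒close-points e 2^n≤e (s , R , surj) =
        s i₀ , λ σ σ≤n → let p , σ⊑p = extension σ σ≤n ; j , eq = surj p in
          s j , (λ τ → near i₀ j τ , near j i₀ τ) ,
          proj₂ (proj₂ (branch (s j))) σ (subst (σ ⊑_) (sym eq) σ⊑p)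
        where
        i₀ : Path n
        i₀ = replicate n false

        open Room R

        peak : Tree ℕ n
        peak = tabulate λ i → coord i (s i)

        at-peak : ∀ i → at peak i ≡ coord i (s i)
        at-peak = at-tabulate λ i → coord i (s i)

        s≤peak : ∀ j → proj₁ (s j) ≤ₜ peak
        s≤peak j i = subst (coord i (s j) ≤_) (sym (at-peak i))
          (rank≤⇒coord≤ i {s j} {s i} (rank≤ (em {j ≡ i})))
          where
          rank≤ : Dec (j ≡ i) → rank i (s j) ≤ rank i (s i)
          rank≤ (yes refl) = ≤-refl
          rank≤ (no j≢i)   = <⇒≤ (maximal i j j≢i)

        -- Some point of the room has colour `i`, hence positive mass at `i`. So `pred` below lowers
        -- the peak by a full unit at every leaf.
        peak>0 : ∀ i → 0 < coord i (s i)
        peak>0 i with j , refl ← surj i =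
          ≤-trans (proj₁ (proj₂ (branch (s j)))) (subst (coord i (s j) ≤_) (at-peak i) (s≤peak j i))

        below-peak : Tree ℕ n
        below-peak = tabulate λ i → pred (coord i (s i))

        at-below-peak : ∀ i → at below-peak i ≡ pred (coord i (s i))
        at-below-peak = at-tabulate λ i → pred (coord i (s i))

        peak-suc : ∀ i → at peak i ≡ suc (at below-peak i)
        peak-suc i = trans (at-peak i)
          (trans (sym (suc-pred _ {{>-nonZero (peak>0 i)}})) (cong suc (sym (at-below-peak i))))

        -- Otherwise some grid point is below the room in every coordinate.
        below-peak<m : mass below-peak [] < m
        below-peak<m = ≰⇒> λ m≤ → let y , y≤ , y≡m = shrink below-peak m m≤ in
          ¬all-below {y , y≡m} λ i → coord<⇒rank< i {y , y≡m} {s i}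
            (≤-trans (s≤s (y≤ i)) (≤-reflexive (trans (sym (peak-suc i)) (at-peak i))))

        gap : ∀ j τ → mass peak τ ≤ mass (proj₁ (s j)) τ + e
        gap j = mass-gap (proj₁ (s j)) peak (s≤peak j) (begin
          mass peak []                   ≡⟨ mass-suc below-peak peak peak-suc ⟩
          mass below-peak [] + 2 ^ n     ≤⟨ +-monoˡ-≤ (2 ^ n) (<⇒≤ below-peak<m) ⟩
          m + 2 ^ n                      ≤⟨ +-monoʳ-≤ m 2^n≤e ⟩
          m + e                          ≡⟨ cong (λ a → a + e) (proj₂ (s j)) ⟨
          mass (proj₁ (s j)) [] + e      ∎)
          where open ≤-Reasoning

        near : ∀ i j τ → mass (proj₁ (s i)) τ ≤ mass (proj₁ (s j)) τ + e
        near i j τ = ≤-trans (mass-mono (proj₁ (s i)) peak (s≤peak i) τ) (gap j τ)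

      abstract
        close-grid-points : ∀ e → 2 ^ n ≤ e → Close-points e
        close-grid-points e 2^n≤e = room⇒close-points e 2^n≤e (panchromatic-room (replicate n false))

-- Closeness of rationals

sub-≤⁺ : ∀ p q {e} → p ℚ.≤ q ℚ.+ e → p ℚ.- q ℚ.≤ e
sub-≤⁺ p q {e} h = begin
  p ℚ.- q           ≤⟨ ℚ.+-monoˡ-≤ (ℚ.- q) h ⟩
  (q ℚ.+ e) ℚ.- q   ≡⟨ solve 2 (λ q e → (q :+ e) :- q := e) refl q e ⟩
  e                 ∎
  where
  open ℚ.≤-Reasoning
  open +-*-Solver

record Close (e p q : ℚ) : Set where
  constructor close
  field
    upper : p ℚ.≤ q ℚ.+ e
    lower : q ℚ.≤ p ℚ.+ e

open Close

close-sym : ∀ {e p q} → Close e p q → Close e q p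
close-sym (close l u) = close u l

close-trans : ∀ {e d p q r} → Close e p q → Close d q r → Close (e ℚ.+ d) p r
close-trans {e} {d} {p} {q} {r} (close u l) (close u′ l′) = close
  (begin
    p                 ≤⟨ u ⟩
    q ℚ.+ e           ≤⟨ ℚ.+-monoˡ-≤ e u′ ⟩
    r ℚ.+ d ℚ.+ e     ≡⟨ solve 3 (λ r d e → r :+ d :+ e := r :+ (e :+ d)) refl r d e ⟩
    r ℚ.+ (e ℚ.+ d)   ∎)
  (begin
    r                 ≤⟨ l′ ⟩
    q ℚ.+ d           ≤⟨ ℚ.+-monoˡ-≤ d l ⟩
    p ℚ.+ e ℚ.+ d     ≡⟨ ℚ.+-assoc p e d ⟩
    p ℚ.+ (e ℚ.+ d)   ∎)
  where
  open ℚ.≤-Reasoning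
  open +-*-Solver

close-+ : ∀ {e d p q p′ q′} → Close e p q → Close d p′ q′ → Close (e ℚ.+ d) (p ℚ.+ p′) (q ℚ.+ q′)
close-+ {e} {d} {p} {q} {p′} {q′} (close u l) (close u′ l′) = close
  (ℚ.≤-trans (ℚ.+-mono-≤ u u′) (ℚ.≤-reflexive (interchange q e q′ d)))
  (ℚ.≤-trans (ℚ.+-mono-≤ l l′) (ℚ.≤-reflexive (interchange p e p′ d)))
  where
  open +-*-Solver
  interchange : ∀ a b c d → (a ℚ.+ b) ℚ.+ (c ℚ.+ d) ≡ (a ℚ.+ c) ℚ.+ (b ℚ.+ d)
  interchange = solve 4 (λ a b c d → (a :+ b) :+ (c :+ d) := (a :+ c) :+ (b :+ d)) refl

close⇒∣-∣≤ : ∀ {e p q} → Close e p q → ∣ p ℚ.- q ∣ ℚ.≤ e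
close⇒∣-∣≤ {e} {p} {q} (close u l) with ℚ.∣p∣≡p∨∣p∣≡-p (p ℚ.- q)
... | inj₁ eq = subst (ℚ._≤ e) (sym eq) (sub-≤⁺ p q u)
... | inj₂ eq = subst (ℚ._≤ e) (sym (trans eq (solve 2 (λ p q → :- (p :- q) := q :- p) refl p q))) (sub-≤⁺ q p l)
  where open +-*-Solver

abstract
  1/1+-mono : ∀ {m n} → m ≤ n → 1/1+ n ℚ.≤ 1/1+ m
  1/1+-mono {m} {n} m≤n = /-mono-≤ 1 1 (suc n) (suc m) (*-monoʳ-≤ 1 (s≤s m≤n))

  0≤1/1+ : ∀ n → 0ℚ ℚ.≤ 1/1+ n
  0≤1/1+ n = /-mono-≤ 0 1 1 (suc n) z≤n

  2/1+≡ : ∀ n → 2/1+ n ≡ 1/1+ n ℚ.+ 1/1+ n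
  2/1+≡ n = /-homo-+ 1 1 (suc n)

  halves : ∀ n → 1/1+ (suc (n + n)) ℚ.+ 1/1+ (suc (n + n)) ≡ 1/1+ n
  halves n = trans (sym (/-homo-+ 1 1 (suc (suc (n + n)))))
    (ℚ.≤-antisym (/-mono-≤ 2 1 (suc (suc (n + n))) (suc n) (≤-reflexive (ident n)))
                 (/-mono-≤ 1 2 (suc n) (suc (suc (n + n))) (≤-reflexive (sym (ident n)))))
    where
    ident : ∀ n → 2 * suc n ≡ 1 * suc (suc (n + n))
    ident = solve-∀

  step : ℕ → ℕ → ℚ
  step k j = + j / suc k

  step-0 : ∀ k → step k 0 ≡ 0ℚ
  step-0 k = ℚ.0/n≡0 (suc k)

  step-suc : ∀ k j → step k (suc j) ≡ step k j ℚ.+ 1/1+ k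
  step-suc k j = trans (/-homo-+ 1 j (suc k)) (ℚ.+-comm (1/1+ k) (step k j))

  step-1 : ∀ k → step k (suc k) ≡ 1ℚ
  step-1 k = ℚ.≤-antisym (/-mono-≤ (suc k) 1 (suc k) 1 (≤-reflexive (*-comm (suc k) 1)))
                         (/-mono-≤ 1 (suc k) 1 (suc k) (≤-reflexive (*-comm 1 (suc k))))

  dyadic≥0 : ∀ {q} → IsDyadic q → 0ℚ ℚ.≤ q
  dyadic≥0 (n , k , refl) = /-mono-≤ 0 n 1 (2 ^ k) {{_}} {{m^n≢0 2 k}} z≤n

≤-+ʳ : ∀ {p q e} → p ℚ.≤ q → 0ℚ ℚ.≤ e → p ℚ.≤ q ℚ.+ e
≤-+ʳ {p} {q} {e} p≤q 0≤e = ℚ.≤-trans (ℚ.≤-reflexive (sym (ℚ.+-identityʳ p))) (ℚ.+-mono-≤ p≤q 0≤e)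

1/1+≤2/1+ : ∀ n → 1/1+ n ℚ.≤ 2/1+ n
1/1+≤2/1+ n = ℚ.≤-trans (≤-+ʳ ℚ.≤-refl (0≤1/1+ n)) (ℚ.≤-reflexive (sym (2/1+≡ n)))

fromℚ-mono : ∀ {p q} → p ℚ.≤ q → fromℚ p ℝ.≤ fromℚ q
fromℚ-mono {p} {q} p≤q n = sub-≤⁺ p q (≤-+ʳ p≤q (ℚ.≤-trans (0≤1/1+ n) (1/1+≤2/1+ n)))

-- Limits

module Suprema (em : ExcludedMiddle 0ℓ) where

  module _ {I : Set} (i₀ : I) (f : I → ℚ) (0≤f : ∀ i → 0ℚ ℚ.≤ f i) (f≤1 : ∀ i → f i ℚ.≤ 1ℚ) where

    private
      -- Descends from 1 through the multiples of `1/1+ k` to the first one that some value reaches.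
      -- If none above 0 is reached, all values are 0.
      approximate : ∀ k j → (∀ i → f i ℚ.≤ step k j) →
                    ∃ λ r → (∃ λ i → r ℚ.≤ f i) × (∀ i → f i ℚ.≤ r ℚ.+ 1/1+ k)
      approximate k zero    ub = f i₀ , (i₀ , ℚ.≤-refl) , λ i →
        ≤-+ʳ (ℚ.≤-trans (ub i) (ℚ.≤-trans (ℚ.≤-reflexive (step-0 k)) (0≤f i₀))) (0≤1/1+ k)
      approximate k (suc j) ub with em {∃ λ i → step k j ℚ.≤ f i}
      ... | yes w = step k j , w , λ i → ℚ.≤-trans (ub i) (ℚ.≤-reflexive (step-suc k j))
      ... | no ∄i = approximate k j λ i → ℚ.<⇒≤ (ℚ.≰⇒> λ le → ∄i (i , le))

      approximation : ∀ k → ∃ λ r → (∃ λ i → r ℚ.≤ f i) × (∀ i → f i ℚ.≤ r ℚ.+ 1/1+ k)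
      approximation k = approximate k (suc k) λ i → ℚ.≤-trans (f≤1 i) (ℚ.≤-reflexive (sym (step-1 k)))

    abstract
      supremum : ∃ λ s → IsSupremum (fromℚ ∘ f) s
      supremum = s , record { upperBound = upperBound ; least = least′ }
        where
        r : ℕ → ℚ
        r k = proj₁ (approximation k)
        r≤ : ∀ m n → r m ℚ.≤ r n ℚ.+ 1/1+ n
        r≤ m n = let i , r≤fi = proj₁ (proj₂ (approximation m)) in
          ℚ.≤-trans r≤fi (proj₂ (proj₂ (approximation n)) i)
        s : ℝ
        s .approx = r
        s .regular m n = close⇒∣-∣≤ (close
          (ℚ.≤-trans (r≤ m n) (ℚ.+-monoʳ-≤ (r n) (ℚ.≤-trans (≤-+ʳ ℚ.≤-refl (0≤1/1+ m)) (ℚ.≤-reflexive (ℚ.+-comm (1/1+ n) (1/1+ m))))))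
          (ℚ.≤-trans (r≤ n m) (ℚ.+-monoʳ-≤ (r m) (≤-+ʳ ℚ.≤-refl (0≤1/1+ n)))))
        upperBound : ∀ i → fromℚ (f i) ℝ.≤ s
        upperBound i k = ℚ.≤-trans (sub-≤⁺ (f i) (r k) (proj₂ (proj₂ (approximation k)) i)) (1/1+≤2/1+ k)
        least′ : ∀ b → (∀ i → fromℚ (f i) ℝ.≤ b) → s ℝ.≤ b
        least′ b ub k = let i , r≤fi = proj₁ (proj₂ (approximation k)) in
          ℚ.≤-trans (ℚ.+-monoˡ-≤ (ℚ.- approx b k) r≤fi) (ub i k)

-- Coding of strings with precisions

-- `ℕᵇ` is bijective base-two notation, so its numerals correspond exactly to binary strings,
-- without leading zeros to discount.
bits : ℕᵇ → Str
bits ℕᵇ.zero  = []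
bits 2[1+ b ] = false ∷ bits b
bits 1+[2 b ] = true ∷ bits b

unbits : Str → ℕᵇ
unbits []          = ℕᵇ.zero
unbits (false ∷ σ) = 2[1+ unbits σ ]
unbits (true  ∷ σ) = 1+[2 unbits σ ]

bits-unbits : ∀ σ → bits (unbits σ) ≡ σ
bits-unbits []          = refl
bits-unbits (false ∷ σ) = cong (false ∷_) (bits-unbits σ)
bits-unbits (true  ∷ σ) = cong (true ∷_) (bits-unbits σ)

-- The pair of `σ` and `k` is coded as `k` zeros, a one, and then `σ`. Strings without a one decode
-- to an irrelevant default, as only surjectivity of `decode` matters.
unprefix : Str → Str × ℕ
unprefix []          = [] , 0
unprefix (true  ∷ σ) = σ , 0
unprefix (false ∷ σ) = let τ , k = unprefix σ in τ , suc k

prefix : Str → ℕ → Str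
prefix σ zero    = true ∷ σ
prefix σ (suc k) = false ∷ prefix σ k

unprefix-prefix : ∀ σ k → unprefix (prefix σ k) ≡ (σ , k)
unprefix-prefix σ zero    = refl
unprefix-prefix σ (suc k) = cong (λ (τ , k) → τ , suc k) (unprefix-prefix σ k)

abstract
  decode : ℕ → Str × ℕ
  decode j = unprefix (bits (fromℕ j))

  encode : Str → ℕ → ℕ
  encode σ k = ℕᵇ.toℕ (unbits (prefix σ k))

  decode-encode : ∀ σ k → decode (encode σ k) ≡ (σ , k)
  decode-encode σ k = trans (cong (unprefix ∘ bits) (fromℕ-toℕ (unbits (prefix σ k))))
    (trans (cong unprefix (bits-unbits (prefix σ k))) (unprefix-prefix σ k))

-- Compactness by a chain of infinite index sets

Infinite : (ℕ → Set) → Set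
Infinite S = ∀ b → ∃ λ n → b ≤ n × S n

module Compactness (em : ExcludedMiddle 0ℓ) where

  finite-below : ∀ {S} → ¬ Infinite S → ∃ λ b → ∀ n → b ≤ n → ¬ S n
  finite-below {S} fin with em {∃ λ b → ∀ n → b ≤ n → ¬ S n}
  ... | yes w = w
  ... | no ∄b = contradiction inf fin
    where
    inf : Infinite S
    inf b with em {∃ λ n → b ≤ n × S n}
    ... | yes w = w
    ... | no ∄n = contradiction (b , λ n b≤n Sn → ∄n (n , b≤n , Sn)) ∄b

  module _ (v : ℕ → ℚ) (0≤v : ∀ n → 0ℚ ℚ.≤ v n) (v≤1 : ∀ n → v n ℚ.≤ 1ℚ)
           {S : ℕ → Set} (inf : Infinite S) (k : ℕ) where

    private
      -- Descends while infinitely many values stay below the next multiple. At the first failure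
      -- almost all remaining values lie in one interval of length `1/1+ k`.
      narrow : ∀ j → Infinite (λ n → S n × v n ℚ.≤ step k j) →
               ∃ λ r → Infinite (λ n → S n × Close (1/1+ k) (v n) r)
      narrow zero inf′ = 0ℚ , λ b → let n , b≤n , Sn , v≤0 = inf′ b in n , b≤n , Sn ,
        close (≤-+ʳ (ℚ.≤-trans v≤0 (ℚ.≤-reflexive (step-0 k))) (0≤1/1+ k)) (≤-+ʳ (0≤v n) (0≤1/1+ k))
      narrow (suc j) inf′ with em {Infinite (λ n → S n × v n ℚ.≤ step k j)}
      ... | yes inf″ = narrow j inf″
      ... | no fin with b₀ , above ← finite-below fin = step k j , λ b →
        let n , b≤n , Sn , v≤ = inf′ (b ⊔ b₀) in
        n , ≤-trans (m≤m⊔n b b₀) b≤n , Sn , close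
          (ℚ.≤-trans v≤ (ℚ.≤-reflexive (step-suc k j)))
          (≤-+ʳ (ℚ.<⇒≤ (ℚ.≰⇒> λ le → above n (≤-trans (m≤n⊔m b b₀) b≤n) (Sn , le))) (0≤1/1+ k))

    abstract
      cluster : ∃ λ r → Infinite (λ n → S n × Close (1/1+ k) (v n) r)
      cluster = narrow (suc k) λ b → let n , b≤n , Sn = inf b in
        n , b≤n , Sn , ℚ.≤-trans (v≤1 n) (ℚ.≤-reflexive (sym (step-1 k)))

  module Limit (X : ℕ → Str → ℚ) (0≤X : ∀ n σ → 0ℚ ℚ.≤ X n σ) (X≤1 : ∀ n σ → X n σ ℚ.≤ 1ℚ) where

    -- Each stage thins out the previous one so as to fix one value, at the string and precision
    -- given by `decode j`. No diagonal subsequence is extracted: late members of late stages, as in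
    -- `Eventually`, serve the same purpose.
    stage : ℕ → Σ (ℕ → Set) Infinite
    centre : ∀ j → let S , _ = stage j ; σ , k = decode j in
             ∃ λ r → Infinite (λ n → S n × Close (1/1+ k) (X n σ) r)
    stage zero    = (λ _ → ⊤) , λ b → b , ≤-refl , tt
    stage (suc j) = _ , proj₂ (centre j)
    centre j = cluster (λ n → X n (proj₁ (decode j))) (λ n → 0≤X n _) (λ n → X≤1 n _)
                 (proj₂ (stage j)) (proj₂ (decode j))

    Eventually : (ℕ → Set) → Set
    Eventually Q = ∃ λ j → ∀ n → j ≤ n → proj₁ (stage j) n → Q n

    stage-anti : ∀ {i j n} → i ≤ j → proj₁ (stage j) n → proj₁ (stage i) n
    stage-anti {n = n} i≤j = go (≤⇒≤′ i≤j)
      where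
      go : ∀ {i j} → i ≤′ j → proj₁ (stage j) n → proj₁ (stage i) n
      go ≤′-refl     Sn       = Sn
      go (≤′-step p) (Sn , _) = go p Sn

    eventually⇒∃ : ∀ {Q} → Eventually Q → ∃ Q
    eventually⇒∃ (j , h) with n , j≤n , Sn ← proj₂ (stage j) j = n , h n j≤n Sn

    eventually-× : ∀ {P Q} → Eventually P → Eventually Q → Eventually (λ n → P n × Q n)
    eventually-× (i , f) (j , g) = i ⊔ j , λ n ≤n Sn →
      f n (≤-trans (m≤m⊔n i j) ≤n) (stage-anti (m≤m⊔n i j) Sn) ,
      g n (≤-trans (m≤n⊔m i j) ≤n) (stage-anti (m≤n⊔m i j) Sn)

    eventually-map : ∀ {P Q : ℕ → Set} → (∀ {n} → P n → Q n) → Eventually P → Eventually Q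
    eventually-map f (j , h) = j , λ n j≤n Sn → f (h n j≤n Sn)

    eventually-all : ∀ {A : Set} {Q : A → ℕ → Set} xs → (∀ x → Eventually (Q x)) →
                     Eventually (λ n → ∀ {x} → x ∈ xs → Q x n)
    eventually-all []       h = 0 , λ _ _ _ ()
    eventually-all (x ∷ xs) h = eventually-map
      (λ { (q , qs) (here refl) → q ; (q , qs) (there x∈xs) → qs x∈xs })
      (eventually-× (h x) (eventually-all xs h))

    eventually-≥ : ∀ N → Eventually (N ≤_)
    eventually-≥ N = N , λ n N≤n _ → N≤n

    limit : Str → ℕ → ℚ
    limit σ k = proj₁ (centre (encode σ k))

    eventually-close : ∀ σ k → Eventually (λ n → Close (1/1+ k) (X n σ) (limit σ k))
    eventually-close σ k = suc (encode σ k) , λ n _ (_ , c) →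
      subst (λ (τ , l) → Close (1/1+ l) (X n τ) (limit σ k)) (decode-encode σ k) c

    value∞ : Str → ℝ
    value∞ σ .approx = limit σ
    value∞ σ .regular k l
      with n , c , c′ ← eventually⇒∃ (eventually-× (eventually-close σ k) (eventually-close σ l)) =
      close⇒∣-∣≤ (close-trans (close-sym c) c′)

    module _ (X-total : ∀ n → X n [] ≡ 1ℚ)
             (X-additive : ∀ n σ → X n σ ≡ X n (σ ∷ʳ false) ℚ.+ X n (σ ∷ʳ true)) where

      -- Each law involves finitely many approximate values, so it can be checked at a single index
      -- `n` where `X n` is close to all of them.
      limit-measure : Measure
      limit-measure .Measure.value = value∞
      limit-measure .Measure.value≥0 σ k with n , c ← eventually⇒∃ (eventually-close σ k) =
        ℚ.≤-trans (sub-≤⁺ 0ℚ (limit σ k) (ℚ.≤-trans (0≤X n σ) (upper c))) (1/1+≤2/1+ k)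
      limit-measure .Measure.value≤1 σ k with n , c ← eventually⇒∃ (eventually-close σ k) =
        ℚ.≤-trans (sub-≤⁺ (limit σ k) 1ℚ (ℚ.≤-trans (lower c) (ℚ.+-monoˡ-≤ (1/1+ k) (X≤1 n σ)))) (1/1+≤2/1+ k)
      limit-measure .Measure.total k with n , c ← eventually⇒∃ (eventually-close [] k) =
        ℚ.≤-trans (close⇒∣-∣≤ (close-sym (subst (λ x → Close (1/1+ k) x (limit [] k)) (X-total n) c))) (1/1+≤2/1+ k)
      -- Real addition reads its summands at index `suc (k + k)`; the two children thus cost
      -- `1/1+ k` together, as much as the parent, which adds up to the permitted `2/1+ k`.
      limit-measure .Measure.additive σ k
        with n , c , c₀ , c₁ ← eventually⇒∃ (eventually-× (eventually-close σ k)
               (eventually-× (eventually-close (σ ∷ʳ false) (suc (k + k))) (eventually-close (σ ∷ʳ true) (suc (k + k))))) =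
        ℚ.≤-trans
          (close⇒∣-∣≤ (close-trans (close-sym (subst (λ x → Close (1/1+ k) x (limit σ k)) (X-additive n σ) c)) (close-+ c₀ c₁)))
          (ℚ.≤-reflexive (trans (cong (1/1+ k ℚ.+_) (halves k)) (sym (2/1+≡ k))))

-- Conditions on grid measures

strings : ℕ → List Str
strings zero    = [] ∷ []
strings (suc n) = [] ∷ cartesianProductWith _∷_ (false ∷ true ∷ []) (strings n)

∈-strings : ∀ {n} σ → length σ ≤ n → σ ∈ strings n
∈-strings {zero}  []          _       = here refl
∈-strings {suc n} []          _       = here refl
∈-strings {suc n} (false ∷ σ) (s≤s l) =
  there (∈-cartesianProductWith⁺ _∷_ {xs = false ∷ true ∷ []} (here refl) (∈-strings σ l))
∈-strings {suc n} (true  ∷ σ) (s≤s l) =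
  there (∈-cartesianProductWith⁺ _∷_ {xs = false ∷ true ∷ []} (there (here refl)) (∈-strings σ l))

-- Distinct multiples of the unit differ by at least one unit, which exceeds the tolerance at index
-- `2 * 2 ^ k`.
fromℚ-scale-< : ∀ k {a b} → a < b → fromℚ (scale k a) ℝ.< fromℚ (scale k b)
fromℚ-scale-< k {a} {b} a<b = 2 * 2 ^ k , (begin-strict
  2/1+ (2 * 2 ^ k)                         <⟨ 2/1+<scale k ⟩
  scale k 1                                ≡⟨ solve 2 (λ x y → y := (x :+ y) :- x) refl (scale k a) (scale k 1) ⟩
  (scale k a ℚ.+ scale k 1) ℚ.- scale k a  ≡⟨ cong (ℚ._- scale k a) (scale-+ k a 1) ⟨
  scale k (a + 1) ℚ.- scale k a            ≤⟨ ℚ.+-monoˡ-≤ (ℚ.- scale k a) (scale-mono-≤ k (subst (_≤ b) (+-comm 1 a) a<b)) ⟩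
  scale k b ℚ.- scale k a                  ∎)
  where
  open ℚ.≤-Reasoning
  open +-*-Solver

-- The margin is spent twice: on the distance from z to the centre of a box,
-- and on the radius of the box.
Margin : ℚ → ℚ → ℚ → ℚ → Set
Margin η z p q = 0ℚ ℚ.≤ p × p ℚ.+ (η ℚ.+ η) ℚ.≤ z × z ℚ.+ (η ℚ.+ η) ℚ.≤ q

∸-< : ∀ {m e} → 0 < m → 0 < e → m ∸ e < m
∸-< {suc m} {suc e} _ _ = s≤s (m∸n≤m m e)

module _ (k : ℕ) {n : ℕ} (x : Grid n (2 ^ k)) where

  weight : Str → ℚ
  weight σ = scale k (mass (proj₁ x) σ)

  weight≥0 : ∀ σ → 0ℚ ℚ.≤ weight σ
  weight≥0 σ = ℚ.≤-trans (ℚ.≤-reflexive (sym (scale-0 k))) (scale-mono-≤ k z≤n)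

  weight≤1 : ∀ σ → weight σ ℚ.≤ 1ℚ
  weight≤1 σ = ℚ.≤-trans
    (scale-mono-≤ k (≤-trans (mass≤total (proj₁ x) σ) (≤-reflexive (proj₂ x))))
    (ℚ.≤-reflexive (scale-1 k))

  weight-total : weight [] ≡ 1ℚ
  weight-total = trans (cong (scale k) (proj₂ x)) (scale-1 k)

  weight-additive : ∀ σ → weight σ ≡ weight (σ ∷ʳ false) ℚ.+ weight (σ ∷ʳ true)
  weight-additive σ = trans (cong (scale k) (mass-additive (proj₁ x) σ)) (scale-+ k _ _)

  private
    ≡⇒≃ : ∀ {p q} → p ≡ q → ∀ n → ∣ p ℚ.- q ∣ ℚ.≤ 2/1+ n
    ≡⇒≃ {p} refl n = ℚ.≤-trans (ℚ.≤-reflexive (cong ∣_∣ (ℚ.+-inverseʳ p)))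
      (ℚ.≤-trans (0≤1/1+ n) (1/1+≤2/1+ n))

  grid-measure : Measure
  grid-measure .Measure.value σ    = fromℚ (weight σ)
  grid-measure .Measure.value≥0 σ  = fromℚ-mono (weight≥0 σ)
  grid-measure .Measure.value≤1 σ  = fromℚ-mono (weight≤1 σ)
  grid-measure .Measure.total      = ≡⇒≃ weight-total
  grid-measure .Measure.additive σ = ≡⇒≃ (weight-additive σ)

  -- The subtraction is truncated because endpoints must be nonnegative; on a cylinder of positive
  -- mass the lower endpoint is still strictly smaller.
  interval : ℕ → Str → Maybe (ℚ × ℚ)
  interval e σ with length σ ≤? n | 0 <? mass (proj₁ x) σ
  ... | yes _ | yes _ = just (scale k (mass (proj₁ x) σ ∸ e) , scale k (mass (proj₁ x) σ + e))
  ... | yes _ | no  _ = nothing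
  ... | no  _ | _     = nothing

  interval-just : ∀ e σ → length σ ≤ n → 0 < mass (proj₁ x) σ →
    interval e σ ≡ just (scale k (mass (proj₁ x) σ ∸ e) , scale k (mass (proj₁ x) σ + e))
  interval-just e σ σ≤n pos with length σ ≤? n | 0 <? mass (proj₁ x) σ
  ... | yes _ | yes _ = refl
  ... | yes _ | no ¬p = contradiction pos ¬p
  ... | no ¬l | _     = contradiction σ≤n ¬l

  -- Dyadic numbers in conditions are nonnegative, so no condition mentions a
  -- null cylinder of a measure satisfying it; the box omits those as well.
  box : ∀ e → 0 < e → A
  box e 0<e .A.fun = interval e
  box e 0<e .A.finite = strings n , finite
    where
    finite : ∀ σ → Is-just (interval e σ) → σ ∈ strings n
    finite σ _ with length σ ≤? n
    finite σ _  | yes σ≤n = ∈-strings σ σ≤n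
    finite σ () | no _
  box e 0<e .A.dyadic σ eq with length σ ≤? n | 0 <? mass (proj₁ x) σ | eq
  ... | yes _ | yes _ | refl = scale-dyadic k _ , scale-dyadic k _
  box e 0<e .A.satisfiable = grid-measure , satisfied
    where
    satisfied : grid-measure ⊨ᶠ interval e
    satisfied σ eq with length σ ≤? n | 0 <? mass (proj₁ x) σ | eq
    ... | yes _ | yes pos | refl =
      fromℚ-scale-< k (∸-< pos 0<e) , fromℚ-scale-< k (m<m+n _ 0<e)

  box-refines : ∀ e (0<e : 0 < e) {η z τ p q} → scale k e ℚ.≤ η → Close (scale k e) z (weight τ) →
    length τ ≤ n → Margin η z p q →
    ∃₂ λ p′ q′ → interval e τ ≡ just (p′ , q′) × p ℚ.≤ p′ × q′ ℚ.≤ q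
  box-refines e 0<e {η} {z} {τ} {p} {q} ε≤η c τ≤n (0≤p , p≤ , ≤q) =
    _ , _ , interval-just e τ τ≤n (≤-trans 0<e e≤mass) , lower-bound , upper-bound
    where
    open ℚ.≤-Reasoning
    open +-*-Solver
    M : ℕ
    M = mass (proj₁ x) τ
    ε w : ℚ
    ε = scale k e
    w = weight τ
    p+ε≤w : p ℚ.+ ε ℚ.≤ w
    p+ε≤w = ℚ-cancel-≤ (ℚ.≤-refl {ε}) (begin
      ε ℚ.+ (p ℚ.+ ε)    ≡⟨ solve 2 (λ e p → e :+ (p :+ e) := p :+ (e :+ e)) refl ε p ⟩
      p ℚ.+ (ε ℚ.+ ε)    ≤⟨ ℚ.+-monoʳ-≤ p (ℚ.+-mono-≤ ε≤η ε≤η) ⟩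
      p ℚ.+ (η ℚ.+ η)    ≤⟨ p≤ ⟩
      z                  ≤⟨ Close.upper c ⟩
      w ℚ.+ ε            ≡⟨ ℚ.+-comm w ε ⟩
      ε ℚ.+ w            ∎)
    -- Since `p` is nonnegative, the margin forces the mass to be at least `e`. So `τ` is in the
    -- domain of the box and `M ∸ e` is not truncated.
    e≤mass : e ≤ M
    e≤mass = ≮⇒≥ λ M<e → ℚ.<-irrefl refl (begin-strict
      w        <⟨ scale-mono-< k M<e ⟩
      ε        ≡⟨ ℚ.+-identityˡ ε ⟨
      0ℚ ℚ.+ ε ≤⟨ ℚ.+-monoˡ-≤ ε 0≤p ⟩
      p ℚ.+ ε  ≤⟨ p+ε≤w ⟩
      w        ∎)
    lower-bound : p ℚ.≤ scale k (M ∸ e)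
    lower-bound = ℚ-cancel-≤ (ℚ.≤-refl {ε}) (begin
      ε ℚ.+ p               ≡⟨ ℚ.+-comm ε p ⟩
      p ℚ.+ ε               ≤⟨ p+ε≤w ⟩
      w                     ≡⟨ cong (scale k) (m+[n∸m]≡n e≤mass) ⟨
      scale k (e + (M ∸ e)) ≡⟨ scale-+ k e (M ∸ e) ⟩
      ε ℚ.+ scale k (M ∸ e) ∎)
    upper-bound : scale k (M + e) ℚ.≤ q
    upper-bound = begin
      scale k (M + e)    ≡⟨ scale-+ k M e ⟩
      w ℚ.+ ε            ≤⟨ ℚ.+-monoˡ-≤ ε (Close.lower c) ⟩
      z ℚ.+ ε ℚ.+ ε      ≡⟨ ℚ.+-assoc z ε ε ⟩
      z ℚ.+ (ε ℚ.+ ε)    ≤⟨ ℚ.+-monoʳ-≤ z (ℚ.+-mono-≤ ε≤η ε≤η) ⟩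
      z ℚ.+ (η ℚ.+ η)    ≤⟨ ≤q ⟩
      q                  ∎

-- Approximants and passage to the limit

-- What the limit argument retains of a cluster: the condition `a` may vary with `σ`, but it always
-- refines whatever `point` satisfies with a margin.
record Approximant (T : Test) (n : ℕ) : Set where
  field
    point          : Str → ℚ
    point≥0        : ∀ σ → 0ℚ ℚ.≤ point σ
    point≤1        : ∀ σ → point σ ℚ.≤ 1ℚ
    point-total    : point [] ≡ 1ℚ
    point-additive : ∀ σ → point σ ≡ point (σ ∷ʳ false) ℚ.+ point (σ ∷ʳ true)
    passes-nearby  : ∀ σ → length σ ≤ n → ∃ λ a →
      B.val (Test.apply T a) σ ℚ.≤ point σ ℚ.+ 1/1+ n ×
      (∀ τ {p q} → length τ ≤ n → Margin (1/1+ n) (point τ) p q →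
        ∃₂ λ p′ q′ → A.fun a τ ≡ just (p′ , q′) × p ℚ.≤ p′ × q′ ℚ.≤ q)

module Proof (em : ExcludedMiddle 0ℓ) (T : Test) where

  module _ (n k e : ℕ) (2^d≤e : 2 ^ suc n ≤ e) (0<e : 0 < e) (ε≤ : scale k e ℚ.≤ 1/1+ n) where
    private
      family : ∃ λ (x : Grid (suc n) (2 ^ k)) → ∀ σ → length σ ≤ suc n → ∃ λ (y : Grid (suc n) (2 ^ k)) →
        (∀ τ → mass (proj₁ x) τ ≤ mass (proj₁ y) τ + e × mass (proj₁ y) τ ≤ mass (proj₁ x) τ + e) ×
        B.val (Test.apply T (box k y e 0<e)) σ ℚ.≤ scale k (mass (proj₁ y) σ)
      family = Grids.close-grid-points em n k (λ y → Test.apply T (box k y e 0<e)) e 2^d≤e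

      x : Grid (suc n) (2 ^ k)
      x = proj₁ family

      scale-+-≤ : ∀ a b → a ≤ b + e → scale k a ℚ.≤ scale k b ℚ.+ scale k e
      scale-+-≤ a b le = ℚ.≤-trans (scale-mono-≤ k le) (ℚ.≤-reflexive (scale-+ k b e))

      nearby : ∀ σ → length σ ≤ n → ∃ λ a →
        B.val (Test.apply T a) σ ℚ.≤ weight k x σ ℚ.+ 1/1+ n ×
        (∀ τ {p q} → length τ ≤ n → Margin (1/1+ n) (weight k x τ) p q →
          ∃₂ λ p′ q′ → A.fun a τ ≡ just (p′ , q′) × p ℚ.≤ p′ × q′ ℚ.≤ q)
      nearby σ σ≤n with y , near , le ← proj₂ family σ (m≤n⇒m≤1+n σ≤n) =
        box k y e 0<e ,
        ℚ.≤-trans le (ℚ.≤-trans (scale-+-≤ _ (mass (proj₁ x) σ) (proj₂ (near σ))) (ℚ.+-monoʳ-≤ (weight k x σ) ε≤)) ,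
        λ τ τ≤n margin → box-refines k y e 0<e {η = 1/1+ n} {z = weight k x τ} ε≤
          (close (scale-+-≤ (mass (proj₁ x) τ) (mass (proj₁ y) τ) (proj₁ (near τ)))
                 (scale-+-≤ (mass (proj₁ y) τ) (mass (proj₁ x) τ) (proj₂ (near τ))))
          (m≤n⇒m≤1+n τ≤n) margin

    approximant′ : Approximant T n
    approximant′ = record
      { point          = weight k x
      ; point≥0        = weight≥0 k x
      ; point≤1        = weight≤1 k x
      ; point-total    = weight-total k x
      ; point-additive = weight-additive k x
      ; passes-nearby  = nearby
      }

  abstract
    approximant : ∀ n → Approximant T n
    -- Depth `suc n`, denominator `4 ^ suc n`, and as tolerance the number of leaves `2 ^ suc n`.
    approximant n = approximant′ n (suc n + suc n) (2 ^ suc n) ≤-refl (m^n>0 2 (suc n))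
      (scale≤1/1+ (suc n) n (≤-trans (n≤1+n (suc n)) (n<2^n (suc n))))

  module N n = Approximant (approximant n)

  X : ℕ → Str → ℚ
  X n = N.point n

  open Compactness em
  open Limit X (λ n → N.point≥0 n) (λ n → N.point≤1 n)

  μ : Measure
  μ = limit-measure (λ n → N.point-total n) (λ n → N.point-additive n)

  Fits : A → ℕ → Str → Set
  Fits a n τ = length τ ≤ n × (∀ {p q} → A.fun a τ ≡ just (p , q) → Margin (1/1+ n) (X n τ) p q)

  small : ∀ N {n} → suc (N + N) ≤ n → 1/1+ n ℚ.+ 1/1+ n ℚ.≤ 1/1+ N
  small N le = ℚ.≤-trans (ℚ.+-mono-≤ (1/1+-mono le) (1/1+-mono le)) (ℚ.≤-reflexive (halves N))

  -- The strict inequality leaves a gap of `2/1+ N`. Half of it pays for the distance from `X n` to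
  -- the limit, and the other half covers the margin once `n` is at least `2N + 1`.
  eventually-above : ∀ τ {p} → fromℚ p ℝ.< value μ τ →
                     Eventually (λ n → p ℚ.+ (1/1+ n ℚ.+ 1/1+ n) ℚ.≤ X n τ)
  eventually-above τ {p} (N , lt) = eventually-map (λ { {n} (c , le) → bound c le })
    (eventually-× (eventually-close τ N) (eventually-≥ (suc (N + N))))
    where
    e = 1/1+ N
    L = limit τ N
    bound : ∀ {n} → Close e (X n τ) L → suc (N + N) ≤ n → p ℚ.+ (1/1+ n ℚ.+ 1/1+ n) ℚ.≤ X n τ
    bound {n} c le = ℚ-cancel-≤ (ℚ.≤-refl {e}) (begin
      e ℚ.+ (p ℚ.+ (1/1+ n ℚ.+ 1/1+ n))  ≤⟨ ℚ.+-monoʳ-≤ e (ℚ.+-monoʳ-≤ p (small N le)) ⟩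
      e ℚ.+ (p ℚ.+ e)                    ≡⟨ solve 2 (λ e p → e :+ (p :+ e) := p :+ (e :+ e)) refl e p ⟩
      p ℚ.+ (e ℚ.+ e)                    ≡⟨ cong (p ℚ.+_) (2/1+≡ N) ⟨
      p ℚ.+ 2/1+ N                       ≤⟨ ℚ.+-monoʳ-≤ p (ℚ.<⇒≤ lt) ⟩
      p ℚ.+ (L ℚ.- p)                    ≡⟨ solve 2 (λ p l → p :+ (l :- p) := l) refl p L ⟩
      L                                  ≤⟨ Close.lower c ⟩
      X n τ ℚ.+ e                        ≡⟨ ℚ.+-comm (X n τ) e ⟩
      e ℚ.+ X n τ                        ∎)
      where
      open ℚ.≤-Reasoning
      open +-*-Solver

  eventually-below : ∀ τ {q} → value μ τ ℝ.< fromℚ q →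
                     Eventually (λ n → X n τ ℚ.+ (1/1+ n ℚ.+ 1/1+ n) ℚ.≤ q)
  eventually-below τ {q} (N , lt) = eventually-map (λ { {n} (c , le) → bound c le })
    (eventually-× (eventually-close τ N) (eventually-≥ (suc (N + N))))
    where
    e = 1/1+ N
    L = limit τ N
    bound : ∀ {n} → Close e (X n τ) L → suc (N + N) ≤ n → X n τ ℚ.+ (1/1+ n ℚ.+ 1/1+ n) ℚ.≤ q
    bound {n} c le = begin
      X n τ ℚ.+ (1/1+ n ℚ.+ 1/1+ n)      ≤⟨ ℚ.+-mono-≤ (Close.upper c) (small N le) ⟩
      L ℚ.+ e ℚ.+ e                      ≡⟨ ℚ.+-assoc L e e ⟩
      L ℚ.+ (e ℚ.+ e)                    ≡⟨ cong (L ℚ.+_) (2/1+≡ N) ⟨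
      L ℚ.+ 2/1+ N                       ≤⟨ ℚ.+-monoʳ-≤ L (ℚ.<⇒≤ lt) ⟩
      L ℚ.+ (q ℚ.- L)                    ≡⟨ solve 2 (λ q l → l :+ (q :- l) := q) refl q L ⟩
      q                                  ∎
      where
      open ℚ.≤-Reasoning
      open +-*-Solver

  eventually-fits : ∀ a → μ ⊨ a → ∀ τ → Eventually (λ n → Fits a n τ)
  eventually-fits a μ⊨a τ = eventually-× (eventually-≥ (length τ)) (go (A.fun a τ) refl)
    where
    go : ∀ m → A.fun a τ ≡ m → Eventually (λ n → ∀ {p q} → A.fun a τ ≡ just (p , q) → Margin (1/1+ n) (X n τ) p q)
    go nothing        eq = 0 , λ _ _ _ eq′ → contradiction (trans (sym eq) eq′) λ ()
    go (just (p , q)) eq = eventually-map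
      (λ {n} h {p′} {q′} eq′ → subst₂ (Margin (1/1+ n) (X n τ))
        (cong proj₁ (just-injective (trans (sym eq) eq′))) (cong proj₂ (just-injective (trans (sym eq) eq′)))
        (dyadic≥0 (proj₁ (A.dyadic a τ eq)) , h))
      (eventually-× (eventually-above τ (proj₁ (μ⊨a τ eq))) (eventually-below τ (proj₂ (μ⊨a τ eq))))

  nearby-condition : ∀ a {n} σ → (∀ {τ} → τ ∈ proj₁ (A.finite a) → Fits a n τ) → length σ ≤ n →
                     ∃ λ b → a ≤A b × B.val (Test.apply T b) σ ℚ.≤ X n σ ℚ.+ 1/1+ n
  nearby-condition a {n} σ fit σ≤n = let b , Tb≤ , refines = N.passes-nearby n σ σ≤n in
    b , (λ τ eq →
      let τ≤n , h = fit (proj₂ (A.finite a) τ (subst Is-just (sym eq) (Maybe.just tt)))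
      in refines τ τ≤n (h eq)) , Tb≤

  -- As `a` has finite domain, one `n` fits it everywhere at once. The two errors, from passing only
  -- nearby and from the distance to the limit, are at most `1/1+ k` each, which is the tolerance of
  -- the real order at index `k`.
  T≤μ : ∀ a → μ ⊨ a → ∀ σ → fromℚ (B.val (Test.apply T a) σ) ℝ.≤ value μ σ
  T≤μ a μ⊨a σ k = bound (eventually⇒∃ (eventually-×
    (eventually-all (proj₁ (A.finite a)) (eventually-fits a μ⊨a))
    (eventually-× (eventually-close σ k) (eventually-× (eventually-≥ (length σ)) (eventually-≥ k)))))
    where
    L : ℚ
    L = limit σ k
    bound : (∃ λ n → (∀ {τ} → τ ∈ proj₁ (A.finite a) → Fits a n τ) ×
              Close (1/1+ k) (X n σ) L × length σ ≤ n × k ≤ n) →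
            B.val (Test.apply T a) σ ℚ.- L ℚ.≤ 2/1+ k
    bound (n , fit , c , σ≤n , k≤n) = let b , a≤b , Tb≤ = nearby-condition a σ fit σ≤n in
      sub-≤⁺ (B.val (Test.apply T a) σ) L (begin
        B.val (Test.apply T a) σ   ≤⟨ Test.mono T {a} {b} a≤b σ ⟩
        B.val (Test.apply T b) σ   ≤⟨ Tb≤ ⟩
        X n σ ℚ.+ 1/1+ n           ≤⟨ ℚ.+-mono-≤ (Close.upper c) (1/1+-mono k≤n) ⟩
        L ℚ.+ 1/1+ k ℚ.+ 1/1+ k    ≡⟨ ℚ.+-assoc L (1/1+ k) (1/1+ k) ⟩
        L ℚ.+ (1/1+ k ℚ.+ 1/1+ k)  ≡⟨ cong (L ℚ.+_) (2/1+≡ k) ⟨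
        L ℚ.+ 2/1+ k               ∎)
      where open ℚ.≤-Reasoning

  -- Every measure satisfies the empty condition, so the supremum defining T(μ) is over an inhabited
  -- family.
  trivial : A
  trivial .A.fun _       = nothing
  trivial .A.finite      = [] , λ _ ()
  trivial .A.dyadic _ ()
  trivial .A.satisfiable = μ , λ _ ()

  μ-passes : μ passes T
  μ-passes = proj₁ ∘ T∞ , proj₂ ∘ T∞ , λ σ → IsSupremum.least (proj₂ (T∞ σ)) (value μ σ) λ (a , μ⊨a) → T≤μ a μ⊨a σ
    where
    open Suprema em
    T∞ : ∀ σ → ∃ λ s → IsSupremum {I = Σ A (μ ⊨_)} (λ i → fromℚ (B.val (Test.apply T (proj₁ i)) σ)) s
    T∞ σ = supremum (trivial , λ _ ()) (λ i → B.val (Test.apply T (proj₁ i)) σ)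
      (λ i → B.val≥0 (Test.apply T (proj₁ i)) σ) (λ i → B.val≤1 (Test.apply T (proj₁ i)) σ)

theorem4p3 : ExcludedMiddle 0ℓ → (T : Test) → ∃ λ (μ : Measure) → μ passes T
theorem4p3 em T = μ , μ-passes
  where open Proof em T
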